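{- Let $G$ be a finite group, $H$ a subgroup, and $S=\{s_1,\ldots,s_k\}\subseteq G\setminus H$ a set of representatives of pairwise distinct double cosets $HsH$ with $\langle H,S\rangle=G$, and suppose $\mathcal{G}=\mathcal{G}(G,H,S)$ is not complete. Suppose $\mathcal{G}$ is hierarchical with respect to this ordering, i.e. the subgroups $G_i=\langle H,s_1,\ldots,s_i\rangle$ ($1\le i\le k$) are distinct. Let $d_i=d_{s_1}+\cdots+d_{s_i}$. Suppose that $d_{s_{i+1}}\leq d_i$ for each $i$ and that $|G_1/H|\geq d_2$. Then $\kappa(\mathcal{G})=d(\mathcal{G})$.
   Context: The Cayley coset digraph $\mathcal{G}(G,H,S)$ has vertex set $G/H$ of left cosets of $H$, and $(gH,g'H)$ is an edge iff $gHs\cap g'H\neq\emptyset$ for some $s\in S$. For $s\in S$, $d_s=|HsH/H|$ is the number of left cosets of $H$ contained in $HsH$; the degree of $\mathcal{G}$ is $d(\mathcal{G})=\sum_{s\in S}d_s$. $|G_1/H|$ is the index of $H$ in $G_1$. $\kappa$ denotes the vertex connectivity: the smallest number of vertices whose removal leaves a digraph that is not strongly connected (for a complete digraph on $m$ vertices it is $m-1$). -}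

module Defs where

open import Data.Nat using (ℕ; _≤_; _<_; _<?_)
open import Data.Fin using (Fin; toℕ)
open import Data.Fin.Subset using (Subset; _∈_; _∉_)
open import Data.Fin.Subset.Properties using (_∈?_)
open import Data.Fin.Properties using (all?; any?)
open import Data.Nat.Properties using (_≤?_)
open import Data.List using (List; length; filter; map; allFin)
open import Data.Nat.ListAction using (sum)
open import Data.Product using (Σ; ∃; _×_; _,_)
open import Data.Sum using (_⊎_)
open import Relation.Nullary using (¬_; Dec)
open import Relation.Nullary.Decidable using (_×-dec_; _→-dec_)
open import Relation.Unary using (Decidable)
open import Relation.Binary.PropositionalEquality using (_≡_; _≢_; decSetoid)
open import Data.Fin using (_≟_)
open import Function.Definitions using (Injective)
open import Algebra.Structures using (IsGroup)

-- A finite group: a group structure (w.r.t. propositional equality)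
-- on the finite carrier Fin n.  Every finite group is isomorphic to one
-- of these.

record FinGroup : Set where
  infixl 7 _∙_
  field
    n       : ℕ
    _∙_     : Fin n → Fin n → Fin n
    ε       : Fin n
    _⁻¹     : Fin n → Fin n
    isGroup : IsGroup _≡_ _∙_ ε _⁻¹

module _ (G : FinGroup) where
  open FinGroup G

  record IsSubgroup (H : Subset n) : Set where
    field
      ε∈   : ε ∈ H
      ∙∈   : ∀ {x y} → x ∈ H → y ∈ H → (x ∙ y) ∈ H
      ⁻¹∈  : ∀ {x} → x ∈ H → (x ⁻¹) ∈ H

  data Gen (P : Fin n → Set) : Fin n → Set where
    gen : ∀ {x} → P x → Gen P x
    one : Gen P ε
    mul : ∀ {x y} → Gen P x → Gen P y → Gen P (x ∙ y)
    inv : ∀ {x} → Gen P x → Gen P (x ⁻¹)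

  module CosetGraph (H : Subset n) {k : ℕ} (S : Fin k → Fin n) where

    InDouble : Fin n → Fin n → Set
    InDouble s x = ∃ λ h → ∃ λ h' → h ∈ H × h' ∈ H × x ≡ h ∙ s ∙ h'

    inDouble? : ∀ s → Decidable (InDouble s)
    inDouble? s x = any? λ h → any? λ h' →
      (h ∈? H) ×-dec ((h' ∈? H) ×-dec (x ≟ h ∙ s ∙ h'))

    -- Left cosets gH are represented by their canonical representative,
    -- the element of gH that is least in the order of Fin n.
    IsRep : Fin n → Set
    IsRep g = ∀ h → h ∈ H → toℕ g ≤ toℕ (g ∙ h)

    isRep? : Decidable IsRep
    isRep? g = all? λ h → (h ∈? H) →-dec (toℕ g ≤? toℕ (g ∙ h))

    -- d_s = |HsH/H| : number of left cosets of H contained in HsH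
    -- (HsH is a union of left cosets; count their representatives)
    dₛ : Fin n → ℕ
    dₛ s = length (filter (λ x → isRep? x ×-dec inDouble? s x) (allFin n))

    dUpTo : ℕ → ℕ
    dUpTo m = sum (map (λ j → dₛ (S j)) (filter (λ j → toℕ j <? m) (allFin k)))

    degree : ℕ
    degree = dUpTo k

    Gsub : ℕ → Fin n → Set
    Gsub m = Gen (λ x → x ∈ H ⊎ ∃ λ j → toℕ j < m × x ≡ S j)

    Vertex : Fin n → Set
    Vertex = IsRep

    Edge : Fin n → Fin n → Set
    Edge g g' = ∃ λ i → ∃ λ h → ∃ λ h' → h ∈ H × h' ∈ H × g ∙ h ∙ S i ≡ g' ∙ h'

    Complete : Set
    Complete = ∀ u v → Vertex u → Vertex v → u ≢ v → Edge u v

    data Path (V : Fin n → Set) : Fin n → Fin n → Set where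
      here : ∀ {x} → Path V x x
      step : ∀ {x y z} → Edge x y → V y → Path V y z → Path V x z

    StronglyConnected : (Fin n → Set) → Set
    StronglyConnected V = ∀ u v → V u → V v → Path V u v

    record VertexSet (j : ℕ) : Set where
      field
        elt    : Fin j → Fin n
        inj    : Injective _≡_ _≡_ elt
        isVert : ∀ i → Vertex (elt i)

    Remaining : ∀ {j} → VertexSet j → Fin n → Set
    Remaining X v = Vertex v × (∀ i → VertexSet.elt X i ≢ v)

    -- X is a vertex cut: 𝒢 − X is not strongly connected or has at most
    -- one vertex (this gives κ = m − 1 for the complete digraph on m vertices)
    Separating : ∀ {j} → VertexSet j → Set
    Separating X = ¬ StronglyConnected (Remaining X)
                 ⊎ (∀ u v → Remaining X u → Remaining X v → u ≡ v)

    VertexConnectivity≡ : ℕ → Set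
    VertexConnectivity≡ c =
      (Σ (VertexSet c) Separating) × (∀ j → j < c → (X : VertexSet j) → ¬ Separating X)

{-# OPTIONS --safe #-}
-- Subsets of G that are unions of left cosets of H are measured by their number of elements, so every
-- vertex count is scaled by |H|.  A minimal vertex cut is the boundary of a fragment of the digraph or
-- of its reverse; by submodularity, distinct translates of a smallest extremal fragment are disjoint,
-- so its translate through ε is a subgroup K ⊇ H.  It thus suffices that a proper subgroup K ⊇ H has
-- boundary of size at least d.  This is shown by induction along L = G_{m-1} < G_m, using that
-- |G_m/H| at least doubles with m while d_m at most doubles, hence d_m ≤ |G_{m-1}/H|:
--   * if L ⊆ K, the boundary contains a translate of K, which has at least |L| elements;
--   * if K ⊆ L, it contains the boundary inside L, together with HsH outside L for s = s_m;
--   * otherwise it contains the boundary of K ∩ L inside L and a disjoint translate of it.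
module Submission where

open import Defs
open import Data.Bool using (Bool; true; false; not)
open import Data.Bool.Properties using (not-involutive)
open import Data.Empty using (⊥)
open import Data.Nat using (ℕ; zero; suc; _+_; _*_; _∸_; _≤_; _<_; _<?_; _<ᵇ_; z≤n; s≤s; s≤s⁻¹)
open import Data.Nat.Properties hiding (_≟_; suc-injective; 0≢1+n)
open import Data.Nat.ListAction using (sum)
open import Data.Fin using (Fin; zero; suc; toℕ; fromℕ<; _≟_)
open import Data.Fin.Properties using (any?; all?; toℕ-injective; toℕ<n; toℕ-fromℕ<; suc-injective; 0≢1+n; ¬∀⟶∃¬; sequence)
open import Data.Fin.Subset using (Subset; inside; outside; _∈_; _∉_; _⊆_; _∪_; _∩_; ∁; ∣_∣; ⊤; ⁅_⁆; _-_)
open import Data.Fin.Subset.Properties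
open import Data.List as List using (List; []; _∷_; length; filter; map; allFin; concat)
open import Data.List.Properties using (length-++)
open import Data.List.Membership.Propositional using () renaming (_∈_ to _∈ₗ_)
open import Data.List.Membership.Propositional.Properties using (∈-filter⁺; ∈-filter⁻; ∈-allFin; ∈-lookup; ∈-concat⁺′; ∈-concat⁻′; ∈-map⁺; ∈-map⁻)
open import Data.List.Relation.Unary.All as All using (All; []; _∷_)
import Data.List.Relation.Unary.All.Properties as All
open import Data.List.Relation.Unary.AllPairs as AllPairs using (AllPairs; []; _∷_)
import Data.List.Relation.Unary.AllPairs.Properties as AllPairs
import Data.List.Relation.Unary.Any as Any
open import Data.List.Relation.Unary.Any.Properties using (lookup-index)
open import Data.List.Relation.Unary.Unique.Propositional using (Unique)
import Data.List.Relation.Unary.Unique.Propositional.Properties as Unique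
open import Data.Product using (Σ; ∃; _×_; _,_; proj₁; proj₂)
open import Data.Sum using (_⊎_; inj₁; inj₂; [_,_]′)
open import Data.Vec using (tabulate; _∷_; []; here; there)
open import Data.Vec.Properties using (lookup⇒[]=; []=⇒lookup; lookup∘tabulate)
open import Algebra.Properties.CommutativeSemigroup +-commutativeSemigroup using (interchange)
open import Data.Vec.Functional using () renaming (_∷_ to _∷ᶠ_)
open import Effect.Monad using (RawMonad)
open import Function using (_∘_; id)
open import Function.Definitions using (Injective)
open import Relation.Nullary using (¬_; Dec; yes; no; does; contradiction)
open import Relation.Nullary.Decidable using (map′; _×-dec_; ¬?; dec-true; decidable-stable; ¬¬-excluded-middle)
open import Relation.Nullary.Negation using (¬¬-Monad; ¬¬-map)
open import Relation.Unary using (Decidable)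
open import Relation.Binary.PropositionalEquality using (_≡_; _≢_; refl; sym; trans; cong; cong₂; subst; subst₂; module ≡-Reasoning)
open import Algebra.Bundles using (Group)
import Algebra.Properties.Group as GroupProperties

private variable
  m n : ℕ
  p q r : Subset n

-- Cardinalities of decidable subsets of a finite set.

⟦_⟧ : {P : Fin n → Set} → Decidable P → Subset n
⟦ P? ⟧ = tabulate (does ∘ P?)

module _ {P : Fin n → Set} (P? : Decidable P) where

  ∈⟦⟧⁺ : ∀ {x} → P x → x ∈ ⟦ P? ⟧
  ∈⟦⟧⁺ {x} px = lookup⇒[]= x _ (trans (lookup∘tabulate _ x) (dec-true (P? x) px))

  ∈⟦⟧⁻ : ∀ {x} → x ∈ ⟦ P? ⟧ → P x
  ∈⟦⟧⁻ {x} x∈ with P? x | trans (sym (lookup∘tabulate (does ∘ P?) x)) ([]=⇒lookup x∈)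
  ... | yes px | _ = px
  ... | no _ | ()

-- Induction along `p`: each time an element of `p` is met, its image is deleted from `q`, and
-- injectivity keeps the later images away from it.
∣∣-injection : {p : Subset m} {q : Subset n} (f : Fin m → Fin n) → Injective _≡_ _≡_ f →
               (∀ {x} → x ∈ p → f x ∈ q) → ∣ p ∣ ≤ ∣ q ∣
∣∣-injection {p = []} f inj into = z≤n
∣∣-injection {p = outside ∷ p} f inj into =
  ∣∣-injection (f ∘ suc) (suc-injective ∘ inj) (into ∘ there)
∣∣-injection {p = inside ∷ p} {q} f inj into = ≤-trans
  (s≤s (∣∣-injection {q = q - f zero} (f ∘ suc) (suc-injective ∘ inj)
    (λ x∈p → x∈p∧x≢y⇒x∈p-y (into (there x∈p)) (0≢1+n ∘ sym ∘ inj))))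
  (x∈p⇒∣p-x∣<∣p∣ (into here))

∣p∪q∣+∣p∩q∣≡∣p∣+∣q∣ : (p q : Subset n) → ∣ p ∪ q ∣ + ∣ p ∩ q ∣ ≡ ∣ p ∣ + ∣ q ∣
∣p∪q∣+∣p∩q∣≡∣p∣+∣q∣ [] [] = refl
∣p∪q∣+∣p∩q∣≡∣p∣+∣q∣ (outside ∷ p) (outside ∷ q) = ∣p∪q∣+∣p∩q∣≡∣p∣+∣q∣ p q
∣p∪q∣+∣p∩q∣≡∣p∣+∣q∣ (outside ∷ p) (inside ∷ q) =
  trans (cong suc (∣p∪q∣+∣p∩q∣≡∣p∣+∣q∣ p q)) (sym (+-suc ∣ p ∣ ∣ q ∣))
∣p∪q∣+∣p∩q∣≡∣p∣+∣q∣ (inside ∷ p) (outside ∷ q) = cong suc (∣p∪q∣+∣p∩q∣≡∣p∣+∣q∣ p q)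
∣p∪q∣+∣p∩q∣≡∣p∣+∣q∣ (inside ∷ p) (inside ∷ q) = cong suc
  (trans (+-suc _ _) (trans (cong suc (∣p∪q∣+∣p∩q∣≡∣p∣+∣q∣ p q)) (sym (+-suc ∣ p ∣ ∣ q ∣))))

∣∣-disjoint : {p q r : Subset n} → p ⊆ r → q ⊆ r → (∀ {x} → x ∈ p → x ∉ q) → ∣ p ∣ + ∣ q ∣ ≤ ∣ r ∣
∣∣-disjoint {n} {p} {q} {r} p⊆r q⊆r p#q = begin
  ∣ p ∣ + ∣ q ∣           ≡⟨ ∣p∪q∣+∣p∩q∣≡∣p∣+∣q∣ p q ⟨
  ∣ p ∪ q ∣ + ∣ p ∩ q ∣   ≡⟨ cong (∣ p ∪ q ∣ +_) ∣p∩q∣≡0 ⟩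
  ∣ p ∪ q ∣ + 0           ≡⟨ +-identityʳ _ ⟩
  ∣ p ∪ q ∣               ≤⟨ p⊆q⇒∣p∣≤∣q∣ ([ p⊆r , q⊆r ]′ ∘ x∈p∪q⁻ p q) ⟩
  ∣ r ∣                   ∎
  where
  open ≤-Reasoning
  ∣p∩q∣≡0 : ∣ p ∩ q ∣ ≡ 0
  ∣p∩q∣≡0 = trans
    (cong ∣_∣ (Empty-unique λ (x , x∈) → let x∈p , x∈q = x∈p∩q⁻ p q x∈ in p#q x∈p x∈q))
    (∣⊥∣≡0 n)

∣∣-cover : (∀ {x} → x ∈ r → x ∈ p ⊎ x ∈ q) → ∣ r ∣ ≤ ∣ p ∣ + ∣ q ∣
∣∣-cover {r = r} {p} {q} cover = begin
  ∣ r ∣                   ≤⟨ p⊆q⇒∣p∣≤∣q∣ (x∈p∪q⁺ ∘ cover) ⟩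
  ∣ p ∪ q ∣               ≤⟨ m≤m+n _ _ ⟩
  ∣ p ∪ q ∣ + ∣ p ∩ q ∣   ≡⟨ ∣p∪q∣+∣p∩q∣≡∣p∣+∣q∣ p q ⟩
  ∣ p ∣ + ∣ q ∣           ∎
  where open ≤-Reasoning

∣p∣+∣∁p∣≡n : (p : Subset n) → ∣ p ∣ + ∣ ∁ p ∣ ≡ n
∣p∣+∣∁p∣≡n p = trans (cong (∣ p ∣ +_) (∣∁p∣≡n∸∣p∣ p)) (m+[n∸m]≡n (∣p∣≤n p))

∣p∣<n⇒∃∉ : {p : Subset n} → ∣ p ∣ < n → ∃ λ x → x ∉ p
∣p∣<n⇒∃∉ {n} {p} ∣p∣<n = ¬∀⟶∃¬ n (_∈ p) (_∈? p)
  λ all → <⇒≱ ∣p∣<n (subst (_≤ ∣ p ∣) (∣⊤∣≡n n) (p⊆q⇒∣p∣≤∣q∣ {p = ⊤} (λ {x} _ → all x)))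

p⊆q∧∣q∣≤∣p∣⇒q⊆p : p ⊆ q → ∣ q ∣ ≤ ∣ p ∣ → q ⊆ p
p⊆q∧∣q∣≤∣p∣⇒q⊆p {p = p} p⊆q ∣q∣≤∣p∣ {x} x∈q with x ∈? p
... | yes x∈p = x∈p
... | no x∉p = contradiction (p⊂q⇒∣p∣<∣q∣ (p⊆q , x , x∈q , x∉p)) (≤⇒≯ ∣q∣≤∣p∣)

-- Partial sums, lists without repetition, and double negation.

prefixSum : (Fin n → ℕ) → ℕ → ℕ
prefixSum f zero = 0
prefixSum {zero} f (suc m) = 0
prefixSum {suc n} f (suc m) = f zero + prefixSum (f ∘ suc) m

prefixSum-suc : (f : Fin n → ℕ) (i : Fin n) →
                prefixSum f (suc (toℕ i)) ≡ prefixSum f (toℕ i) + f i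
prefixSum-suc f zero = +-comm (f zero) 0
prefixSum-suc f (suc i) =
  trans (cong (f zero +_) (prefixSum-suc (f ∘ suc) i)) (sym (+-assoc (f zero) _ _))

-- The enumeration `g` is arbitrary and the test is compared with `_<ᵇ_` as a Boolean, so that the
-- induction can pass to `g ∘ suc`: there `suc (toℕ j) <ᵇ suc m` computes to `toℕ j <ᵇ m`.
sum-filter-tabulate : {A : Set} {P : A → Set} (P? : Decidable P) (f : A → ℕ) (g : Fin n → A) (m : ℕ) →
  (∀ j → does (P? (g j)) ≡ (toℕ j <ᵇ m)) →
  sum (map f (filter P? (List.tabulate g))) ≡ prefixSum (f ∘ g) m
sum-filter-tabulate {zero} P? f g zero eq = refl
sum-filter-tabulate {zero} P? f g (suc m) eq = refl
sum-filter-tabulate {suc n} P? f g zero eq rewrite eq zero =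
  sum-filter-tabulate P? f (g ∘ suc) zero (eq ∘ suc)
sum-filter-tabulate {suc n} P? f g (suc m) eq rewrite eq zero =
  cong (f (g zero) +_) (sum-filter-tabulate P? f (g ∘ suc) m (eq ∘ suc))

length-concat-map : {A B : Set} (f : A → List B) (xs : List A) →
                    length (concat (map f xs)) ≡ sum (map (length ∘ f) xs)
length-concat-map f [] = refl
length-concat-map f (x ∷ xs) =
  trans (length-++ (f x)) (cong (length (f x) +_) (length-concat-map f xs))

Unique⇒lookup-injective : {A : Set} {xs : List A} → Unique xs → Injective _≡_ _≡_ (List.lookup xs)
Unique⇒lookup-injective (_ ∷ _) {zero} {zero} _ = refl
Unique⇒lookup-injective (x∉xs ∷ _) {zero} {suc j} eq = contradiction eq (All.lookup x∉xs (∈-lookup j))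
Unique⇒lookup-injective (x∉xs ∷ _) {suc i} {zero} eq = contradiction (sym eq) (All.lookup x∉xs (∈-lookup i))
Unique⇒lookup-injective (_ ∷ xs!) {suc i} {suc j} eq = cong suc (Unique⇒lookup-injective xs! eq)

-- Finitely many doubly negated cases of excluded middle combine into one. Inequalities of natural
-- numbers are stable, so in proving them the inductively generated `Gsub m` may be treated as a
-- subset with a size.
¬¬-decidable : (P : Fin n → Set) → ¬ ¬ Decidable P
¬¬-decidable P = sequence (RawMonad.rawApplicative ¬¬-Monad) λ x → ¬¬-excluded-middle

-- Left cosets, translates and canonical representatives.

module Cosets (G : FinGroup) (H : Subset (FinGroup.n G)) (H-isSubgroup : IsSubgroup G H) where
  open FinGroup G renaming (n to ∣G∣)

  group : Group _ _
  group = record { isGroup = isGroup }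

  open Group group using (assoc; identityˡ; identityʳ; inverseˡ; inverseʳ) public
  open GroupProperties group public
  open IsSubgroup H-isSubgroup public using () renaming (ε∈ to ε∈H; ∙∈ to ∙∈H; ⁻¹∈ to ⁻¹∈H)

  infix 4 _∼_
  _∼_ : Fin ∣G∣ → Fin ∣G∣ → Set
  x ∼ y = x ⁻¹ ∙ y ∈ H

  ∼-refl : ∀ x → x ∼ x
  ∼-refl x = subst (_∈ H) (sym (inverseˡ x)) ε∈H

  ∼-sym : ∀ x y → x ∼ y → y ∼ x
  ∼-sym x y x∼y = subst (_∈ H) (⁻¹-anti-homo-\\ x y) (⁻¹∈H x∼y)

  ∼-trans : ∀ x y z → x ∼ y → y ∼ z → x ∼ z
  ∼-trans x y z x∼y y∼z = subst (_∈ H)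
    (trans (assoc (x ⁻¹) y (y ⁻¹ ∙ z)) (cong (x ⁻¹ ∙_) (\\-leftDividesˡ y z))) (∙∈H x∼y y∼z)

  x∼xh : ∀ x {h} → h ∈ H → x ∼ x ∙ h
  x∼xh x {h} = subst (_∈ H) (sym (\\-leftDividesʳ x h))

  [gx]⁻¹[gy]≡x⁻¹y : ∀ g x y → (g ∙ x) ⁻¹ ∙ (g ∙ y) ≡ x ⁻¹ ∙ y
  [gx]⁻¹[gy]≡x⁻¹y g x y = begin
    (g ∙ x) ⁻¹ ∙ (g ∙ y)      ≡⟨ cong (_∙ (g ∙ y)) (⁻¹-anti-homo-∙ g x) ⟩
    x ⁻¹ ∙ g ⁻¹ ∙ (g ∙ y)     ≡⟨ assoc (x ⁻¹) (g ⁻¹) (g ∙ y) ⟩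
    x ⁻¹ ∙ (g ⁻¹ ∙ (g ∙ y))   ≡⟨ cong (x ⁻¹ ∙_) (\\-leftDividesʳ g y) ⟩
    x ⁻¹ ∙ y                  ∎
    where open ≡-Reasoning

  ∼-translate : ∀ g x y → x ∼ y → g ∙ x ∼ g ∙ y
  ∼-translate g x y = subst (_∈ H) (sym ([gx]⁻¹[gy]≡x⁻¹y g x y))

  ∼-untranslate : ∀ g x y → g ∙ x ∼ g ∙ y → x ∼ y
  ∼-untranslate g x y = subst (_∈ H) ([gx]⁻¹[gy]≡x⁻¹y g x y)

  ∙-injectiveˡ : ∀ g → Injective _≡_ _≡_ (g ∙_)
  ∙-injectiveˡ g {x} {y} eq = trans (sym (\\-leftDividesʳ g x))
    (trans (cong (g ⁻¹ ∙_) eq) (\\-leftDividesʳ g y))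

  ∙-injectiveʳ : ∀ g → Injective _≡_ _≡_ (_∙ g)
  ∙-injectiveʳ g {x} {y} eq = trans (sym (//-rightDividesʳ g x))
    (trans (cong (_∙ g ⁻¹) eq) (//-rightDividesʳ g y))

  module Subgroup {K : Subset ∣G∣} (K-isSubgroup : IsSubgroup G K) where
    open IsSubgroup K-isSubgroup public

    cancelˡ : ∀ {x y} → x ∈ K → x ∙ y ∈ K → y ∈ K
    cancelˡ {x} {y} x∈K xy∈K = subst (_∈ K) (\\-leftDividesʳ x y) (∙∈ (⁻¹∈ x∈K) xy∈K)

    cancelʳ : ∀ {x y} → y ∈ K → x ∙ y ∈ K → x ∈ K
    cancelʳ {x} {y} y∈K xy∈K = subst (_∈ K) (//-rightDividesʳ y x) (∙∈ xy∈K (⁻¹∈ y∈K))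

    ⁻¹∈⁻ : ∀ {x} → x ⁻¹ ∈ K → x ∈ K
    ⁻¹∈⁻ {x} x⁻¹∈K = subst (_∈ K) (⁻¹-involutive x) (⁻¹∈ x⁻¹∈K)

    respects∼ : H ⊆ K → ∀ {x y} → x ∼ y → x ∈ K → y ∈ K
    respects∼ H⊆K x∼y x∈K = cancelˡ (⁻¹∈ x∈K) (H⊆K x∼y)

  -- These are the unions of left cosets of `H`, that is, sets of vertices viewed inside `G`.
  Saturated : Subset ∣G∣ → Set
  Saturated X = ∀ {x y} → x ∼ y → x ∈ X → y ∈ X

  coset? : ∀ a → Decidable (a ∼_)
  coset? a y = a ⁻¹ ∙ y ∈? H

  coset-saturated : ∀ a → Saturated ⟦ coset? a ⟧
  coset-saturated a {x} {y} x∼y x∈ =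
    ∈⟦⟧⁺ (coset? a) (∼-trans a x y (∈⟦⟧⁻ (coset? a) x∈) x∼y)

  ∣coset∣≤∣H∣ : ∀ a → ∣ ⟦ coset? a ⟧ ∣ ≤ ∣ H ∣
  ∣coset∣≤∣H∣ a = ∣∣-injection (a ⁻¹ ∙_) (∙-injectiveˡ (a ⁻¹)) (∈⟦⟧⁻ (coset? a))

  ∣H∣≤∣coset∣ : ∀ a → ∣ H ∣ ≤ ∣ ⟦ coset? a ⟧ ∣
  ∣H∣≤∣coset∣ a = ∣∣-injection (a ∙_) (∙-injectiveˡ a) (λ h∈H → ∈⟦⟧⁺ (coset? a) (x∼xh a h∈H))

  1≤∣H∣ : 1 ≤ ∣ H ∣
  1≤∣H∣ = subst (_≤ ∣ H ∣) (∣⁅x⁆∣≡1 ε)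
    (p⊆q⇒∣p∣≤∣q∣ λ x∈ → subst (_∈ H) (sym (x∈⁅y⁆⇒x≡y _ x∈)) ε∈H)

  infixr 8 _◁_
  -- The left translate `gX`, encoded as a preimage so that membership is a single test.
  _◁_ : Fin ∣G∣ → Subset ∣G∣ → Subset ∣G∣
  g ◁ X = ⟦ (λ y → g ⁻¹ ∙ y ∈? X) ⟧

  ∈◁⁺ : ∀ g X {y} → g ⁻¹ ∙ y ∈ X → y ∈ g ◁ X
  ∈◁⁺ g X = ∈⟦⟧⁺ (λ y → g ⁻¹ ∙ y ∈? X)

  ∈◁⁻ : ∀ g X {y} → y ∈ g ◁ X → g ⁻¹ ∙ y ∈ X
  ∈◁⁻ g X = ∈⟦⟧⁻ (λ y → g ⁻¹ ∙ y ∈? X)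

  ∙∈◁ : ∀ g X {x} → x ∈ X → g ∙ x ∈ g ◁ X
  ∙∈◁ g X {x} x∈X = ∈◁⁺ g X (subst (_∈ X) (sym (\\-leftDividesʳ g x)) x∈X)

  ∣◁∣≤ : ∀ g X → ∣ g ◁ X ∣ ≤ ∣ X ∣
  ∣◁∣≤ g X = ∣∣-injection (g ⁻¹ ∙_) (∙-injectiveˡ (g ⁻¹)) (∈◁⁻ g X)

  ≤∣◁∣ : ∀ g X → ∣ X ∣ ≤ ∣ g ◁ X ∣
  ≤∣◁∣ g X = ∣∣-injection (g ∙_) (∙-injectiveˡ g) (∙∈◁ g X)

  ◁-saturated : ∀ g X → Saturated X → Saturated (g ◁ X)
  ◁-saturated g X X-sat {x} {y} x∼y x∈ =
    ∈◁⁺ g X (X-sat (∼-translate (g ⁻¹) x y x∼y) (∈◁⁻ g X x∈))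

  -- The generators are passed to CosetGraph only because IsRep lives there; it does not depend on them.
  module Representatives {k : ℕ} (S : Fin k → Fin ∣G∣) where
    open CosetGraph G H S using (IsRep; isRep?)

    -- Descent inside the coset: if `g` is not its least element, some `g ∙ h` is smaller, and the
    -- bound `b` drops by one.
    least : ∀ b g → toℕ g < b → ∃ λ r → g ∼ r × IsRep r
    least (suc b) g g<b with isRep? g
    ... | yes g-rep = g , ∼-refl g , g-rep
    ... | no ¬g-rep with any? (λ h → (h ∈? H) ×-dec (toℕ (g ∙ h) <? toℕ g))
    ...   | yes (h , h∈H , gh<g) =
            let r , gh∼r , r-rep = least b (g ∙ h) (≤-trans gh<g (s≤s⁻¹ g<b))
            in r , ∼-trans g (g ∙ h) r (x∼xh g h∈H) gh∼r , r-rep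
    ...   | no ¬smaller = contradiction (λ h h∈H → ≮⇒≥ λ gh<g → ¬smaller (h , h∈H , gh<g)) ¬g-rep

    abstract
      rep : Fin ∣G∣ → Fin ∣G∣
      rep g = proj₁ (least ∣G∣ g (toℕ<n g))

      x∼rep : ∀ x → x ∼ rep x
      x∼rep x = proj₁ (proj₂ (least ∣G∣ x (toℕ<n x)))

      rep-isRep : ∀ x → IsRep (rep x)
      rep-isRep x = proj₂ (proj₂ (least ∣G∣ x (toℕ<n x)))

    rep∼x : ∀ x → rep x ∼ x
    rep∼x x = ∼-sym x (rep x) (x∼rep x)

    IsRep-unique : ∀ {a b} → IsRep a → IsRep b → a ∼ b → a ≡ b
    IsRep-unique {a} {b} a-rep b-rep a∼b = toℕ-injective (≤-antisym
      (subst (λ z → toℕ a ≤ toℕ z) (\\-leftDividesˡ a b) (a-rep _ a∼b))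
      (subst (λ z → toℕ b ≤ toℕ z) (\\-leftDividesˡ b a) (b-rep _ (∼-sym a b a∼b))))

    ∼⇒rep≡ : ∀ {x y} → x ∼ y → rep x ≡ rep y
    ∼⇒rep≡ {x} {y} x∼y = IsRep-unique (rep-isRep x) (rep-isRep y)
      (∼-trans (rep x) x (rep y) (rep∼x x) (∼-trans x y (rep y) x∼y (x∼rep y)))

    rep≡⇒∼ : ∀ {x y} → rep x ≡ y → x ∼ y
    rep≡⇒∼ {x} refl = x∼rep x

    IsRep⇒rep≡ : ∀ {v} → IsRep v → rep v ≡ v
    IsRep⇒rep≡ {v} v-rep = IsRep-unique (rep-isRep v) v-rep (rep∼x v)

    -- Distinct representatives have disjoint cosets: once the coset of `r zero` is taken out of
    -- `X`, the rest is still saturated and still contains the other representatives.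
    d*∣H∣≤∣X∣ : ∀ {d} (r : Fin d → Fin ∣G∣) → Injective _≡_ _≡_ r → (∀ i → IsRep (r i)) →
                ∀ {X} → Saturated X → (∀ i → r i ∈ X) → d * ∣ H ∣ ≤ ∣ X ∣
    d*∣H∣≤∣X∣ {zero} r inj r-rep X-sat r∈X = z≤n
    d*∣H∣≤∣X∣ {suc d} r inj r-rep {X} X-sat r∈X = begin
      ∣ H ∣ + d * ∣ H ∣       ≤⟨ +-mono-≤ (∣H∣≤∣coset∣ (r zero))
        (d*∣H∣≤∣X∣ (r ∘ suc) (suc-injective ∘ inj) (r-rep ∘ suc) Y-sat r∈Y) ⟩
      ∣ R₀ ∣ + ∣ Y ∣          ≤⟨ ∣∣-disjoint R₀⊆X (p∩q⊆p X (∁ R₀)) (λ x∈R₀ x∈Y → x∈∁p⇒x∉p (p∩q⊆q X (∁ R₀) x∈Y) x∈R₀) ⟩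
      ∣ X ∣                   ∎
      where
      open ≤-Reasoning
      R₀ = ⟦ coset? (r zero) ⟧
      Y = X ∩ ∁ R₀
      R₀⊆X : R₀ ⊆ X
      R₀⊆X x∈ = X-sat (∈⟦⟧⁻ (coset? (r zero)) x∈) (r∈X zero)
      Y-sat : Saturated Y
      Y-sat {x} {y} x∼y x∈ = let x∈X , x∈∁R₀ = x∈p∩q⁻ X (∁ R₀) x∈ in
        x∈p∩q⁺ (X-sat x∼y x∈X , x∉p⇒x∈∁p λ y∈R₀ →
          x∈∁p⇒x∉p x∈∁R₀ (coset-saturated (r zero) (∼-sym x y x∼y) y∈R₀))
      r∈Y : ∀ i → r (suc i) ∈ Y
      r∈Y i = x∈p∩q⁺ (r∈X (suc i) , x∉p⇒x∈∁p λ rᵢ∈R₀ →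
        0≢1+n (inj (IsRep-unique (r-rep zero) (r-rep (suc i)) (∈⟦⟧⁻ (coset? (r zero)) rᵢ∈R₀))))

    ∣X∣≤d*∣H∣ : ∀ {d} (r : Fin d → Fin ∣G∣) {X} → (∀ {x} → x ∈ X → ∃ λ i → r i ∼ x) →
                ∣ X ∣ ≤ d * ∣ H ∣
    ∣X∣≤d*∣H∣ {zero} r {X} cover = ≤-reflexive (trans
      (cong ∣_∣ (Empty-unique {p = X} λ (x , x∈X) → contradiction (proj₁ (cover x∈X)) λ ())) (∣⊥∣≡0 ∣G∣))
    ∣X∣≤d*∣H∣ {suc d} r {X} cover = begin
      ∣ X ∣                   ≤⟨ ∣∣-cover split ⟩
      ∣ R₀ ∣ + ∣ X ∩ ∁ R₀ ∣   ≤⟨ +-mono-≤ (∣coset∣≤∣H∣ (r zero)) (∣X∣≤d*∣H∣ (r ∘ suc) cover′) ⟩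
      ∣ H ∣ + d * ∣ H ∣       ∎
      where
      open ≤-Reasoning
      R₀ = ⟦ coset? (r zero) ⟧
      split : ∀ {x} → x ∈ X → x ∈ R₀ ⊎ x ∈ X ∩ ∁ R₀
      split {x} x∈X with x ∈? R₀
      ... | yes x∈R₀ = inj₁ x∈R₀
      ... | no x∉R₀ = inj₂ (x∈p∩q⁺ (x∈X , x∉p⇒x∈∁p x∉R₀))
      cover′ : ∀ {x} → x ∈ X ∩ ∁ R₀ → ∃ λ i → r (suc i) ∼ x
      cover′ {x} x∈ with x∈p∩q⁻ X (∁ R₀) x∈
      ... | x∈X , x∈∁R₀ with cover x∈X
      ...   | zero , r₀∼x = contradiction (∈⟦⟧⁺ (coset? (r zero)) r₀∼x) (x∈∁p⇒x∉p x∈∁R₀)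
      ...   | suc i , rᵢ∼x = i , rᵢ∼x

-- Edges, neighbourhoods, degrees and the generated subgroups.

module Connections (G : FinGroup) (H : Subset (FinGroup.n G)) (H-isSubgroup : IsSubgroup G H)
                   {k : ℕ} (S : Fin k → Fin (FinGroup.n G)) where
  open FinGroup G renaming (n to ∣G∣) public
  open Cosets G H H-isSubgroup public
  open Representatives S public
  open CosetGraph G H S public

  -- true: the digraph itself; false: the digraph with all edges reversed.
  generator : Bool → Fin k → Fin ∣G∣
  generator true i = S i
  generator false i = S i ⁻¹

  generator-not : ∀ b i → generator (not b) i ≡ generator b i ⁻¹
  generator-not true i = refl
  generator-not false i = sym (⁻¹-involutive (S i))

  module _ {K : Subset ∣G∣} (K-isSubgroup : IsSubgroup G K) where
    open Subgroup K-isSubgroup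

    generator∈⁺ : ∀ b {i} → S i ∈ K → generator b i ∈ K
    generator∈⁺ true Sᵢ∈K = Sᵢ∈K
    generator∈⁺ false Sᵢ∈K = ⁻¹∈ Sᵢ∈K

    generator∈⁻ : ∀ b {i} → generator b i ∈ K → S i ∈ K
    generator∈⁻ true Sᵢ∈K = Sᵢ∈K
    generator∈⁻ false Sᵢ⁻¹∈K = ⁻¹∈⁻ Sᵢ⁻¹∈K

  -- Edges between the cosets of arbitrary elements, using only the first `m` generators, in the
  -- direction `b`. Left translations act on them without a return to representatives.
  E : Bool → ℕ → Fin ∣G∣ → Fin ∣G∣ → Set
  E b m x y = ∃ λ i → ∃ λ h → toℕ i < m × h ∈ H × x ∙ h ∙ generator b i ∼ y

  E? : ∀ b m x y → Dec (E b m x y)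
  E? b m x y = any? λ i → any? λ h →
    (toℕ i <? m) ×-dec ((h ∈? H) ×-dec ((x ∙ h ∙ generator b i) ⁻¹ ∙ y ∈? H))

  E-mono : ∀ b {m n x y} → m ≤ n → E b m x y → E b n x y
  E-mono b m≤n (i , h , i<m , rest) = i , h , ≤-trans i<m m≤n , rest

  E-generator : ∀ b {m i} → toℕ i < m → ∀ x → E b m x (x ∙ generator b i)
  E-generator b {i = i} i<m x = i , ε , i<m , ε∈H ,
    subst (λ z → z ∙ generator b i ∼ x ∙ generator b i) (sym (identityʳ x)) (∼-refl _)

  E-resp : ∀ b {m} x x′ y y′ → x ∼ x′ → y ∼ y′ → E b m x y → E b m x′ y′
  E-resp b x x′ y y′ x∼x′ y∼y′ (i , h , i<m , h∈H , e) =
    i , x′ ⁻¹ ∙ x ∙ h , i<m , ∙∈H (∼-sym x x′ x∼x′) h∈H ,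
    subst (λ z → z ∙ generator b i ∼ y′) (sym eq) (∼-trans _ y y′ e y∼y′)
    where
    eq : x′ ∙ (x′ ⁻¹ ∙ x ∙ h) ≡ x ∙ h
    eq = trans (cong (x′ ∙_) (assoc (x′ ⁻¹) x h)) (\\-leftDividesˡ x′ (x ∙ h))

  E-translate : ∀ b {m} g x y → E b m x y → E b m (g ∙ x) (g ∙ y)
  E-translate b g x y (i , h , i<m , h∈H , e) = i , h , i<m , h∈H ,
    subst (_∼ g ∙ y) eq (∼-translate g (x ∙ h ∙ generator b i) y e)
    where
    eq : g ∙ (x ∙ h ∙ generator b i) ≡ g ∙ x ∙ h ∙ generator b i
    eq = trans (sym (assoc g (x ∙ h) _)) (cong (_∙ generator b i) (sym (assoc g x h)))

  -- From `x ∙ h ∙ s = y ∙ h′` with `h′ ∈ H` follows `y ∙ h′ ∙ s ⁻¹ = x ∙ h`; the new witness is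
  -- this `h′`.
  E-reverse : ∀ b {m} x y → E b m x y → E (not b) m y x
  E-reverse b x y (i , h , i<m , h∈H , e) = i , y ⁻¹ ∙ a , i<m , ∼-sym a y e ,
    subst (_∼ x) (sym eq) (∼-sym x (x ∙ h) (x∼xh x h∈H))
    where
    a = x ∙ h ∙ generator b i
    eq : y ∙ (y ⁻¹ ∙ a) ∙ generator (not b) i ≡ x ∙ h
    eq = trans (cong₂ _∙_ (\\-leftDividesˡ y a) (generator-not b i))
               (//-rightDividesʳ (generator b i) (x ∙ h))

  E⇒Edge : ∀ x y → E true k x y → Edge x y
  E⇒Edge x y (i , h , _ , h∈H , e) =
    i , h , y ⁻¹ ∙ (x ∙ h ∙ S i) , h∈H , ∼-sym (x ∙ h ∙ S i) y e , sym (\\-leftDividesˡ y _)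

  Edge⇒E : ∀ x y → Edge x y → E true k x y
  Edge⇒E x y (i , h , h′ , h∈H , h′∈H , eq) = i , h , toℕ<n i , h∈H ,
    subst (_∼ y) (sym eq) (∼-sym y (y ∙ h′) (x∼xh y h′∈H))

  N : Bool → ℕ → Subset ∣G∣ → Subset ∣G∣
  N b m X = ⟦ (λ y → any? λ x → (x ∈? X) ×-dec E? b m x y) ⟧

  module _ (b : Bool) (m : ℕ) (X : Subset ∣G∣) {y : Fin ∣G∣} where

    ∈N⁺ : ∀ {x} → x ∈ X → E b m x y → y ∈ N b m X
    ∈N⁺ x∈X e = ∈⟦⟧⁺ (λ y → any? λ x → (x ∈? X) ×-dec E? b m x y) (_ , x∈X , e)

    ∈N⁻ : y ∈ N b m X → ∃ λ x → x ∈ X × E b m x y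
    ∈N⁻ = ∈⟦⟧⁻ (λ y → any? λ x → (x ∈? X) ×-dec E? b m x y)

  ∂ : Bool → ℕ → Subset ∣G∣ → Subset ∣G∣
  ∂ b m X = N b m X ∩ ∁ X

  module _ (b : Bool) (m : ℕ) (X : Subset ∣G∣) {y : Fin ∣G∣} where

    ∈∂⁺ : ∀ {x} → x ∈ X → E b m x y → y ∉ X → y ∈ ∂ b m X
    ∈∂⁺ x∈X e y∉X = x∈p∩q⁺ (∈N⁺ b m X x∈X e , x∉p⇒x∈∁p y∉X)

    ∈∂⁻ : y ∈ ∂ b m X → (∃ λ x → x ∈ X × E b m x y) × y ∉ X
    ∈∂⁻ y∈ = let y∈N , y∈∁X = x∈p∩q⁻ (N b m X) (∁ X) y∈ in ∈N⁻ b m X y∈N , x∈∁p⇒x∉p y∈∁X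

  double-coset-saturated : ∀ s → Saturated ⟦ inDouble? s ⟧
  double-coset-saturated s {x} {y} x∼y x∈ with ∈⟦⟧⁻ (inDouble? s) x∈
  ... | h , h′ , h∈H , h′∈H , x≡ = ∈⟦⟧⁺ (inDouble? s)
    (h , h′ ∙ (x ⁻¹ ∙ y) , h∈H , ∙∈H h′∈H x∼y ,
     trans (sym (\\-leftDividesˡ x y)) (trans (cong (_∙ (x ⁻¹ ∙ y)) x≡) (assoc (h ∙ s) h′ _)))

  dₛ*∣H∣≤∣HsH∣ : ∀ s → dₛ s * ∣ H ∣ ≤ ∣ ⟦ inDouble? s ⟧ ∣
  dₛ*∣H∣≤∣HsH∣ s = d*∣H∣≤∣X∣ (List.lookup reps)
    (Unique⇒lookup-injective (Unique.filter⁺ P? (Unique.allFin⁺ ∣G∣)))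
    (λ i → proj₁ (P-lookup i)) (double-coset-saturated s) (λ i → ∈⟦⟧⁺ (inDouble? s) (proj₂ (P-lookup i)))
    where
    P? : Decidable (λ x → IsRep x × InDouble s x)
    P? x = isRep? x ×-dec inDouble? s x
    reps = filter P? (allFin ∣G∣)
    P-lookup : ∀ i → IsRep (List.lookup reps i) × InDouble s (List.lookup reps i)
    P-lookup i = proj₂ (∈-filter⁻ P? {xs = allFin ∣G∣} (∈-lookup i))

  -- For the reversed digraph, inversion carries `HsH` onto the double coset of `s ⁻¹`, so the same
  -- count serves both directions.
  dₛ*∣H∣≤ : ∀ b i {X} → (∀ {h h′} → h ∈ H → h′ ∈ H → h ∙ generator b i ∙ h′ ∈ X) →
            dₛ (S i) * ∣ H ∣ ≤ ∣ X ∣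
  dₛ*∣H∣≤ true i {X} HsH⊆X = ≤-trans (dₛ*∣H∣≤∣HsH∣ (S i)) (p⊆q⇒∣p∣≤∣q∣ λ x∈ →
    let h , h′ , h∈H , h′∈H , x≡ = ∈⟦⟧⁻ (inDouble? (S i)) x∈ in
    subst (_∈ X) (sym x≡) (HsH⊆X h∈H h′∈H))
  dₛ*∣H∣≤ false i {X} HsH⊆X = ≤-trans (dₛ*∣H∣≤∣HsH∣ (S i)) (∣∣-injection _⁻¹ ⁻¹-injective λ x∈ →
    let h , h′ , h∈H , h′∈H , x≡ = ∈⟦⟧⁻ (inDouble? (S i)) x∈ in
    subst (_∈ X) (sym (trans (cong _⁻¹ x≡) (inverse-triple h (S i) h′)))
      (HsH⊆X (⁻¹∈H h′∈H) (⁻¹∈H h∈H)))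
    where
    inverse-triple : ∀ x y z → (x ∙ y ∙ z) ⁻¹ ≡ z ⁻¹ ∙ y ⁻¹ ∙ x ⁻¹
    inverse-triple x y z = trans (⁻¹-anti-homo-∙ (x ∙ y) z)
      (trans (cong (z ⁻¹ ∙_) (⁻¹-anti-homo-∙ x y)) (sym (assoc (z ⁻¹) (y ⁻¹) (x ⁻¹))))

  dUpTo-suc : ∀ i → dUpTo (suc (toℕ i)) ≡ dUpTo (toℕ i) + dₛ (S i)
  dUpTo-suc i = trans (dUpTo≡ (suc (toℕ i)))
    (trans (prefixSum-suc (dₛ ∘ S) i) (cong (_+ dₛ (S i)) (sym (dUpTo≡ (toℕ i)))))
    where
    dUpTo≡ : ∀ m → dUpTo m ≡ prefixSum (dₛ ∘ S) m
    dUpTo≡ m = sum-filter-tabulate (λ j → toℕ j <? m) (dₛ ∘ S) id m (λ j → refl)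

  Gsub⊆ : ∀ m {K} → IsSubgroup G K → H ⊆ K → (∀ j → toℕ j < m → S j ∈ K) →
          ∀ {x} → Gsub m x → x ∈ K
  Gsub⊆ m K-sub H⊆K S⊆K (gen (inj₁ x∈H)) = H⊆K x∈H
  Gsub⊆ m K-sub H⊆K S⊆K (gen (inj₂ (j , j<m , refl))) = S⊆K j j<m
  Gsub⊆ m K-sub H⊆K S⊆K one = IsSubgroup.ε∈ K-sub
  Gsub⊆ m K-sub H⊆K S⊆K (mul x∈ y∈) =
    IsSubgroup.∙∈ K-sub (Gsub⊆ m K-sub H⊆K S⊆K x∈) (Gsub⊆ m K-sub H⊆K S⊆K y∈)
  Gsub⊆ m K-sub H⊆K S⊆K (inv x∈) = IsSubgroup.⁻¹∈ K-sub (Gsub⊆ m K-sub H⊆K S⊆K x∈)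

  -- Indices of `S` start at zero, so `S i` is the generator added in passing from `Gsub (toℕ i)` to
  -- `Gsub (suc (toℕ i))`. If it is already present, the chain stalls there; distinctness of the
  -- subgroups excludes this.
  Gsub-suc : ∀ i → Gsub (toℕ i) (S i) → ∀ {x} → Gsub (suc (toℕ i)) x → Gsub (toℕ i) x
  Gsub-suc i Sᵢ∈ (gen (inj₁ x∈H)) = gen (inj₁ x∈H)
  Gsub-suc i Sᵢ∈ (gen (inj₂ (j , s≤s j≤i , refl))) with m≤n⇒m<n∨m≡n j≤i
  ... | inj₁ j<i = gen (inj₂ (j , j<i , refl))
  ... | inj₂ j≡i = subst (λ j → Gsub (toℕ i) (S j)) (sym (toℕ-injective j≡i)) Sᵢ∈
  Gsub-suc i Sᵢ∈ one = one
  Gsub-suc i Sᵢ∈ (mul x∈ y∈) = mul (Gsub-suc i Sᵢ∈ x∈) (Gsub-suc i Sᵢ∈ y∈)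
  Gsub-suc i Sᵢ∈ (inv x∈) = inv (Gsub-suc i Sᵢ∈ x∈)

  Gsub-mono : ∀ {m n} → m ≤ n → ∀ {x} → Gsub m x → Gsub n x
  Gsub-mono m≤n (gen (inj₁ x∈H)) = gen (inj₁ x∈H)
  Gsub-mono m≤n (gen (inj₂ (j , j<m , x≡))) = gen (inj₂ (j , ≤-trans j<m m≤n , x≡))
  Gsub-mono m≤n one = one
  Gsub-mono m≤n (mul x∈ y∈) = mul (Gsub-mono m≤n x∈) (Gsub-mono m≤n y∈)
  Gsub-mono m≤n (inv x∈) = inv (Gsub-mono m≤n x∈)

-- Boundaries of subgroups in a hierarchical digraph.

module Hierarchy (G : FinGroup) (H : Subset (FinGroup.n G)) (H-isSubgroup : IsSubgroup G H)
                 {k : ℕ} (S : Fin k → Fin (FinGroup.n G)) where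
  open Connections G H H-isSubgroup S

  -- The degree `d_m`, and in `c` below a single `d_s`, counted in elements of `G` instead of
  -- cosets.
  D : ℕ → ℕ
  D m = dUpTo m * ∣ H ∣

  c : Fin k → ℕ
  c i = dₛ (S i) * ∣ H ∣

  D-suc : ∀ i → D (suc (toℕ i)) ≡ D (toℕ i) + c i
  D-suc i = trans (cong (_* ∣ H ∣) (dUpTo-suc i)) (*-distribʳ-+ ∣ H ∣ (dUpTo (toℕ i)) (dₛ (S i)))

  module _ (m : ℕ) (Gsub? : Decidable (Gsub m)) where

    L : Subset ∣G∣
    L = ⟦ Gsub? ⟧

    L-isSubgroup : IsSubgroup G L
    L-isSubgroup = record
      { ε∈ = ∈⟦⟧⁺ Gsub? one
      ; ∙∈ = λ x∈ y∈ → ∈⟦⟧⁺ Gsub? (mul (∈⟦⟧⁻ Gsub? x∈) (∈⟦⟧⁻ Gsub? y∈))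
      ; ⁻¹∈ = λ x∈ → ∈⟦⟧⁺ Gsub? (inv (∈⟦⟧⁻ Gsub? x∈)) }

    H⊆L : H ⊆ L
    H⊆L h∈H = ∈⟦⟧⁺ Gsub? (gen (inj₁ h∈H))

    S∈L : ∀ j → toℕ j < m → S j ∈ L
    S∈L j j<m = ∈⟦⟧⁺ Gsub? (gen (inj₂ (j , j<m , refl)))

  -- The right translate of `K` by the missing generator is disjoint from `K`, and edges from `K`
  -- end in it.
  ∣K∣≤∣∂K∣ : ∀ b m {K} → IsSubgroup G K → ∀ i → toℕ i < m → S i ∉ K → ∣ K ∣ ≤ ∣ ∂ b m K ∣
  ∣K∣≤∣∂K∣ b m {K} K-sub i i<m Sᵢ∉K = ∣∣-injection (_∙ generator b i) (∙-injectiveʳ _) λ {x} x∈K →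
    ∈∂⁺ b m K x∈K (E-generator b i<m x)
      (Sᵢ∉K ∘ generator∈⁻ K-sub b ∘ Subgroup.cancelˡ K-sub x∈K)

  -- Edges along the generator that start in `H ⊆ K` reach its whole double coset, and this avoids
  -- the subgroup `L` because `L` contains `H` but not the generator.
  c≤∣∂K∖L∣ : ∀ b m {K L} → IsSubgroup G K → IsSubgroup G L → H ⊆ K → H ⊆ L → K ⊆ L →
             ∀ i → toℕ i < m → S i ∉ L → c i ≤ ∣ ∂ b m K ∩ ∁ L ∣
  c≤∣∂K∖L∣ b m {K} {L} K-sub L-sub H⊆K H⊆L K⊆L i i<m Sᵢ∉L = dₛ*∣H∣≤ b i λ {h} {h′} h∈H h′∈H →
    let hsh′∉L = λ hsh′∈L → Sᵢ∉L (generator∈⁻ L-sub b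
          (Subgroup.cancelˡ L-sub (H⊆L h∈H) (Subgroup.cancelʳ L-sub (H⊆L h′∈H) hsh′∈L)))
    in x∈p∩q⁺
      ( ∈∂⁺ b m K (H⊆K h∈H)
          (E-resp b h h (h ∙ generator b i) _ (∼-refl h) (x∼xh _ h′∈H) (E-generator b i<m h))
          (hsh′∉L ∘ K⊆L)
      , x∉p⇒x∈∁p hsh′∉L)

  module Bounds
    (hierarchical : ∀ i → 1 ≤ toℕ i → ¬ Gsub (toℕ i) (S i))
    (c≤D : ∀ i → 1 ≤ toℕ i → c i ≤ D (toℕ i))
    -- This is `|G₁/H| ≥ d₂`, phrased for saturated sets containing `G₁` because `Gsub 1` is a
    -- predicate and not a `Subset`.
    (D₂≤∣G₁∣ : ∀ {K} → Saturated K → (∀ {x} → Gsub 1 x → x ∈ K) → D 2 ≤ ∣ K ∣)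
    where

    D-suc≤ : ∀ i → 1 ≤ toℕ i → D (suc (toℕ i)) ≤ D (toℕ i) + D (toℕ i)
    D-suc≤ i 1≤i = ≤-trans (≤-reflexive (D-suc i)) (+-monoʳ-≤ (D (toℕ i)) (c≤D i 1≤i))

    -- Induction starting from `|G₁/H| ≥ d₂`: each step at most doubles the degree, by `D-suc≤`, and
    -- at least doubles the subgroup, since the previous one and a translate of it are disjoint.
    D≤∣Gᵢ∣ : ∀ m {K} → suc m < k → IsSubgroup G K → H ⊆ K → (∀ {x} → Gsub (suc m) x → x ∈ K) →
             D (suc (suc m)) ≤ ∣ K ∣
    D≤∣Gᵢ∣ zero _ K-sub H⊆K = D₂≤∣G₁∣ (Subgroup.respects∼ K-sub H⊆K)
    D≤∣Gᵢ∣ (suc m) {K} 2+m<k K-sub H⊆K G⊆K = decidable-stable (_ ≤? _)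
      (¬¬-map doubled (¬¬-decidable (Gsub (suc m))))
      where
      -- Degrees run one step ahead of subgroups: `i` gives the last summand of the degree, while
      -- `i′` gives the generator that enlarges `Gsub (suc m)` to `Gsub (suc (suc m))`.
      i = fromℕ< 2+m<k
      i≡ : toℕ i ≡ suc (suc m)
      i≡ = toℕ-fromℕ< 2+m<k
      i′ = fromℕ< (<⇒≤ 2+m<k)
      i′≡ : toℕ i′ ≡ suc m
      i′≡ = toℕ-fromℕ< (<⇒≤ 2+m<k)
      doubled : Decidable (Gsub (suc m)) → D (suc (suc (suc m))) ≤ ∣ K ∣
      doubled Gsub? = begin
        D (suc (suc (suc m)))               ≤⟨ subst (λ z → D (suc z) ≤ D z + D z) i≡ (D-suc≤ i (subst (1 ≤_) (sym i≡) (s≤s z≤n))) ⟩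
        D (suc (suc m)) + D (suc (suc m))   ≤⟨ +-mono-≤ D≤∣M∣ (≤-trans D≤∣M∣ ∣M∣≤∣K∖M∣) ⟩
        ∣ M ∣ + ∣ K ∩ ∁ M ∣                 ≤⟨ ∣∣-disjoint M⊆K (p∩q⊆p K (∁ M)) (λ x∈M x∈ → x∈∁p⇒x∉p (p∩q⊆q K (∁ M) x∈) x∈M) ⟩
        ∣ K ∣                               ∎
        where
        open ≤-Reasoning
        M = L (suc m) Gsub?
        M-sub = L-isSubgroup (suc m) Gsub?
        M⊆K : M ⊆ K
        M⊆K x∈M = G⊆K (Gsub-mono (n≤1+n (suc m)) (∈⟦⟧⁻ Gsub? x∈M))
        s∉M : S i′ ∉ M
        s∉M s∈M = hierarchical i′ (subst (1 ≤_) (sym i′≡) (s≤s z≤n))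
          (subst (λ z → Gsub z (S i′)) (sym i′≡) (∈⟦⟧⁻ Gsub? s∈M))
        s∈K : S i′ ∈ K
        s∈K = G⊆K (gen (inj₂ (i′ , ≤-reflexive (cong suc i′≡) , refl)))
        D≤∣M∣ : D (suc (suc m)) ≤ ∣ M ∣
        D≤∣M∣ = D≤∣Gᵢ∣ m (<⇒≤ 2+m<k) M-sub (H⊆L (suc m) Gsub?) (∈⟦⟧⁺ Gsub?)
        ∣M∣≤∣K∖M∣ : ∣ M ∣ ≤ ∣ K ∩ ∁ M ∣
        ∣M∣≤∣K∖M∣ = ∣∣-injection (S i′ ∙_) (∙-injectiveˡ (S i′)) λ x∈M → x∈p∩q⁺
          ( IsSubgroup.∙∈ K-sub s∈K (M⊆K x∈M)
          , x∉p⇒x∈∁p (s∉M ∘ Subgroup.cancelʳ M-sub x∈M))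

    -- Induction on `m`, with properness of `K` put in the form that one of the first `m + 1`
    -- generators is missing. A missing generator of smaller index allows the induction hypothesis,
    -- for `K` or for `K ∩ M`.
    D≤∣∂K∣ : ∀ b m {K} → suc m ≤ k → IsSubgroup G K → H ⊆ K → ∀ i → toℕ i < suc m → S i ∉ K →
             D (suc m) ≤ ∣ ∂ b (suc m) K ∣
    D≤∣∂K∣ b zero {K} _ K-sub H⊆K i i<1 Sᵢ∉K = begin
      D 1                        ≡⟨ subst (λ z → D (suc z) ≡ D z + c i) (n<1⇒n≡0 i<1) (D-suc i) ⟩
      D 0 + c i                  ≡⟨ cong (λ d → d * ∣ H ∣ + c i) dUpTo0≡0 ⟩
      c i                        ≤⟨ c≤∣∂K∖L∣ b 1 K-sub K-sub H⊆K H⊆K id i i<1 Sᵢ∉K ⟩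
      ∣ ∂ b 1 K ∩ ∁ K ∣          ≤⟨ ∣p∩q∣≤∣p∣ (∂ b 1 K) (∁ K) ⟩
      ∣ ∂ b 1 K ∣                ∎
      where
      open ≤-Reasoning
      dUpTo0≡0 : dUpTo 0 ≡ 0
      dUpTo0≡0 = sum-filter-tabulate (λ j → toℕ j <? 0) (dₛ ∘ S) id 0 (λ j → refl)
    D≤∣∂K∣ b (suc m) {K} 2+m≤k K-sub H⊆K i₀ i₀<2+m Sᵢ₀∉K = decidable-stable (_ ≤? _)
      (¬¬-map bound (¬¬-decidable (Gsub (suc m))))
      where
      i = fromℕ< 2+m≤k
      i≡ : toℕ i ≡ suc m
      i≡ = toℕ-fromℕ< 2+m≤k
      1≤i : 1 ≤ toℕ i
      1≤i = subst (1 ≤_) (sym i≡) (s≤s z≤n)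
      i<2+m : toℕ i < suc (suc m)
      i<2+m = ≤-reflexive (cong suc i≡)
      ∂K = ∂ b (suc (suc m)) K
      bound : Decidable (Gsub (suc m)) → D (suc (suc m)) ≤ ∣ ∂K ∣
      bound Gsub? = cases
        (any? λ j → (toℕ j <? suc m) ×-dec ¬? (S j ∈? K))
        (any? λ g → (g ∈? K) ×-dec ¬? (g ∈? M))
        where
        open ≤-Reasoning
        M = L (suc m) Gsub?
        M-sub = L-isSubgroup (suc m) Gsub?
        H⊆M = H⊆L (suc m) Gsub?
        s∉M : S i ∉ M
        s∉M s∈M = hierarchical i 1≤i (subst (λ z → Gsub z (S i)) (sym i≡) (∈⟦⟧⁻ Gsub? s∈M))

        split : ∀ {B} → B ⊆ ∂K → B ⊆ M → ∣ B ∣ + ∣ ∂K ∩ ∁ M ∣ ≤ ∣ ∂K ∣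
        split B⊆∂K B⊆M = ∣∣-disjoint B⊆∂K (p∩q⊆p ∂K (∁ M))
          (λ x∈B x∈ → x∈∁p⇒x∉p (p∩q⊆q ∂K (∁ M) x∈) (B⊆M x∈B))

        ∂⊆M : ∀ {J} → J ⊆ M → ∂ b (suc m) J ⊆ M
        ∂⊆M {J} J⊆M y∈ = let (x , x∈J , (j , h , j<m , h∈H , e)) , _ = ∈∂⁻ b (suc m) J y∈ in
          Subgroup.respects∼ M-sub H⊆M e
            (IsSubgroup.∙∈ M-sub (IsSubgroup.∙∈ M-sub (J⊆M x∈J) (H⊆M h∈H))
              (generator∈⁺ M-sub b (S∈L (suc m) Gsub? j j<m)))

        cases : Dec (∃ λ j → toℕ j < suc m × S j ∉ K) → Dec (∃ λ g → g ∈ K × g ∉ M) →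
                D (suc (suc m)) ≤ ∣ ∂K ∣
        -- Here `M ⊆ K`, so the size of `K` already dominates the degree, and the missing `S i₀`
        -- pushes a copy of `K` into the boundary.
        cases (no S⊆K) _ = ≤-trans
          (D≤∣Gᵢ∣ m 2+m≤k K-sub H⊆K (Gsub⊆ (suc m) K-sub H⊆K λ j j<m →
            decidable-stable (S j ∈? K) λ Sⱼ∉K → S⊆K (j , j<m , Sⱼ∉K)))
          (∣K∣≤∣∂K∣ b _ K-sub i₀ i₀<2+m Sᵢ₀∉K)
        -- Here `K ⊆ M`: edges along earlier generators stay in `M`, while those from `H` along
        -- `S i` leave it, so the two contributions are disjoint.
        cases (yes (j , j<m , Sⱼ∉K)) (no K⊆M) = begin
          D (suc (suc m))                        ≡⟨ subst (λ z → D (suc z) ≡ D z + c i) i≡ (D-suc i) ⟩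
          D (suc m) + c i                        ≤⟨ +-mono-≤ (D≤∣∂K∣ b m (<⇒≤ 2+m≤k) K-sub H⊆K j j<m Sⱼ∉K)
            (c≤∣∂K∖L∣ b _ K-sub M-sub H⊆K H⊆M K⊆M′ i i<2+m s∉M) ⟩
          ∣ ∂ b (suc m) K ∣ + ∣ ∂K ∩ ∁ M ∣       ≤⟨ split ∂⊆∂K (∂⊆M K⊆M′) ⟩
          ∣ ∂K ∣                                 ∎
          where
          K⊆M′ : K ⊆ M
          K⊆M′ {x} x∈K = decidable-stable (x ∈? M) λ x∉M → K⊆M (x , x∈K , x∉M)
          ∂⊆∂K : ∂ b (suc m) K ⊆ ∂K
          ∂⊆∂K y∈ = let (x , x∈K , e) , y∉K = ∈∂⁻ b (suc m) K y∈ in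
            ∈∂⁺ b _ K x∈K (E-mono b (n≤1+n _) e) y∉K
        -- B ⊆ G_{m+1} and its translate by g ∈ K outside G_{m+1} are disjoint parts of ∂K.
        cases (yes (j , j<m , Sⱼ∉K)) (yes (g , g∈K , g∉M)) = begin
          D (suc (suc m))                        ≤⟨ subst (λ z → D (suc z) ≤ D z + D z) i≡ (D-suc≤ i 1≤i) ⟩
          D (suc m) + D (suc m)                  ≤⟨ +-mono-≤ D≤∣B∣ (≤-trans D≤∣B∣ ∣B∣≤) ⟩
          ∣ B ∣ + ∣ ∂K ∩ ∁ M ∣                   ≤⟨ split B⊆∂K B⊆M ⟩
          ∣ ∂K ∣                                 ∎
          where
          J = K ∩ M
          J-sub : IsSubgroup G J
          J-sub = record
            { ε∈ = x∈p∩q⁺ (IsSubgroup.ε∈ K-sub , IsSubgroup.ε∈ M-sub)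
            ; ∙∈ = λ x∈ y∈ → let x∈K , x∈M = x∈p∩q⁻ K M x∈ ; y∈K , y∈M = x∈p∩q⁻ K M y∈ in
                x∈p∩q⁺ (IsSubgroup.∙∈ K-sub x∈K y∈K , IsSubgroup.∙∈ M-sub x∈M y∈M)
            ; ⁻¹∈ = λ x∈ → let x∈K , x∈M = x∈p∩q⁻ K M x∈ in
                x∈p∩q⁺ (IsSubgroup.⁻¹∈ K-sub x∈K , IsSubgroup.⁻¹∈ M-sub x∈M) }
          B = ∂ b (suc m) J
          D≤∣B∣ : D (suc m) ≤ ∣ B ∣
          D≤∣B∣ = D≤∣∂K∣ b m (<⇒≤ 2+m≤k) J-sub (λ h∈H → x∈p∩q⁺ (H⊆K h∈H , H⊆M h∈H))
            j j<m (Sⱼ∉K ∘ p∩q⊆p K M)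
          B⊆M : B ⊆ M
          B⊆M = ∂⊆M (p∩q⊆q K M)
          ∈B⇒∉K : ∀ {y} → y ∈ B → y ∉ K
          ∈B⇒∉K y∈B y∈K = proj₂ (∈∂⁻ b (suc m) J y∈B) (x∈p∩q⁺ (y∈K , B⊆M y∈B))
          B⊆∂K : B ⊆ ∂K
          B⊆∂K y∈B = let (x , x∈J , e) , _ = ∈∂⁻ b (suc m) J y∈B in
            ∈∂⁺ b _ K (p∩q⊆p K M x∈J) (E-mono b (n≤1+n _) e) (∈B⇒∉K y∈B)
          ∣B∣≤ : ∣ B ∣ ≤ ∣ ∂K ∩ ∁ M ∣
          ∣B∣≤ = ∣∣-injection (g ∙_) (∙-injectiveˡ g) λ {y} y∈B →
            let (x , x∈J , e) , _ = ∈∂⁻ b (suc m) J y∈B in x∈p∩q⁺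
              ( ∈∂⁺ b _ K (IsSubgroup.∙∈ K-sub g∈K (p∩q⊆p K M x∈J))
                  (E-translate b g x y (E-mono b (n≤1+n _) e))
                  (∈B⇒∉K y∈B ∘ Subgroup.cancelˡ K-sub g∈K)
              , x∉p⇒x∈∁p (g∉M ∘ Subgroup.cancelʳ M-sub (B⊆M y∈B)))

-- Fragments, submodularity and atoms.

module Atoms (G : FinGroup) (H : Subset (FinGroup.n G)) (H-isSubgroup : IsSubgroup G H)
             {k : ℕ} (S : Fin k → Fin (FinGroup.n G)) (D : ℕ)
             (D≤∣∂K∣ : ∀ b {K} → IsSubgroup G K → H ⊆ K → ∀ {z} → z ∉ K →
                        D ≤ ∣ Connections.∂ G H H-isSubgroup S b k K ∣) where
  open Connections G H H-isSubgroup S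

  -- The closed neighbourhood: `|φ b X| − |X|` is the size of the boundary of `X`, called the excess
  -- below.
  φ : Bool → Subset ∣G∣ → Subset ∣G∣
  φ b X = X ∪ N b k X

  module _ (b : Bool) (X : Subset ∣G∣) where

    X⊆φX : X ⊆ φ b X
    X⊆φX = p⊆p∪q (N b k X)

    E⇒∈φ : ∀ {x y} → x ∈ X → E b k x y → y ∈ φ b X
    E⇒∈φ x∈X e = q⊆p∪q X (N b k X) (∈N⁺ b k X x∈X e)

    ∈φ⁻ : ∀ {y} → y ∈ φ b X → y ∈ X ⊎ ∃ λ x → x ∈ X × E b k x y
    ∈φ⁻ y∈ with x∈p∪q⁻ X (N b k X) y∈
    ... | inj₁ y∈X = inj₁ y∈X
    ... | inj₂ y∈N = inj₂ (∈N⁻ b k X y∈N)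

    ∣X∣+∣∂X∣≤∣φX∣ : ∣ X ∣ + ∣ ∂ b k X ∣ ≤ ∣ φ b X ∣
    ∣X∣+∣∂X∣≤∣φX∣ = ∣∣-disjoint X⊆φX (q⊆p∪q X (N b k X) ∘ p∩q⊆p (N b k X) (∁ X))
      (λ x∈X x∈∂ → proj₂ (∈∂⁻ b k X x∈∂) x∈X)

    φ-saturated : Saturated X → Saturated (φ b X)
    φ-saturated X-sat {y} {y′} y∼y′ y∈ with ∈φ⁻ y∈
    ... | inj₁ y∈X = X⊆φX (X-sat y∼y′ y∈X)
    ... | inj₂ (x , x∈X , e) = E⇒∈φ x∈X (E-resp b x x y y′ (∼-refl x) y∼y′ e)

  φ-mono : ∀ b {X Y} → X ⊆ Y → φ b X ⊆ φ b Y
  φ-mono b {X} {Y} X⊆Y y∈ with ∈φ⁻ b X y∈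
  ... | inj₁ y∈X = X⊆φX b Y (X⊆Y y∈X)
  ... | inj₂ (x , x∈X , e) = E⇒∈φ b Y (X⊆Y x∈X) e

  φ-∪ : ∀ b X Y → φ b (X ∪ Y) ⊆ φ b X ∪ φ b Y
  φ-∪ b X Y y∈ with ∈φ⁻ b (X ∪ Y) y∈
  ... | inj₁ y∈X∪Y = x∈p∪q⁺ ([ inj₁ ∘ X⊆φX b X , inj₂ ∘ X⊆φX b Y ]′ (x∈p∪q⁻ X Y y∈X∪Y))
  ... | inj₂ (x , x∈X∪Y , e) =
    x∈p∪q⁺ ([ (λ x∈X → inj₁ (E⇒∈φ b X x∈X e)) , (λ x∈Y → inj₂ (E⇒∈φ b Y x∈Y e)) ]′ (x∈p∪q⁻ X Y x∈X∪Y))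

  φ-◁ : ∀ b g X → φ b (g ◁ X) ⊆ g ◁ φ b X
  φ-◁ b g X {y} y∈ with ∈φ⁻ b (g ◁ X) y∈
  ... | inj₁ y∈gX = ∈◁⁺ g _ (X⊆φX b X (∈◁⁻ g X y∈gX))
  ... | inj₂ (x , x∈gX , e) = ∈◁⁺ g _ (E⇒∈φ b X (∈◁⁻ g X x∈gX) (E-translate b (g ⁻¹) x y e))

  ∣φ◁∣≤ : ∀ b g X → ∣ φ b (g ◁ X) ∣ ≤ ∣ φ b X ∣
  ∣φ◁∣≤ b g X = ≤-trans (p⊆q⇒∣p∣≤∣q∣ (φ-◁ b g X)) (∣◁∣≤ g (φ b X))

  -- A reversed edge from outside `φ b X` into `X` would be an edge from `X` leaving its closed
  -- neighbourhood.
  φ-∁φ : ∀ b X → φ (not b) (∁ (φ b X)) ⊆ ∁ X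
  φ-∁φ b X {y} y∈ with ∈φ⁻ (not b) (∁ (φ b X)) y∈
  ... | inj₁ y∈∁φ = x∉p⇒x∈∁p (x∈∁p⇒x∉p y∈∁φ ∘ X⊆φX b X)
  ... | inj₂ (x , x∈∁φ , e) = x∉p⇒x∈∁p λ y∈X → x∈∁p⇒x∉p x∈∁φ (E⇒∈φ b X y∈X
    (subst (λ b → E b k y x) (not-involutive b) (E-reverse (not b) x y e)))

  -- A nonempty set of vertices that, with its boundary, is not everything; deleting the boundary
  -- separates `inner` from `outer`.
  record Fragment (b : Bool) (X : Subset ∣G∣) : Set where
    field
      saturated : Saturated X
      {inner outer} : Fin ∣G∣
      inner∈ : inner ∈ X
      outer∉ : outer ∉ φ b X

  open Fragment

  ∁φ-fragment : ∀ b {X} → Fragment b X → Fragment (not b) (∁ (φ b X))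
  ∁φ-fragment b {X} F = record
    { saturated = λ {x} {y} x∼y x∈ → x∉p⇒x∈∁p λ y∈φ →
        x∈∁p⇒x∉p x∈ (φ-saturated b X (saturated F) (∼-sym x y x∼y) y∈φ)
    ; inner∈ = x∉p⇒x∈∁p (outer∉ F)
    ; outer∉ = λ x∈ → x∈∁p⇒x∉p (φ-∁φ b X x∈) (inner∈ F) }

  ◁-fragment : ∀ b g {X} → Fragment b X → Fragment b (g ◁ X)
  ◁-fragment b g {X} F = record
    { saturated = ◁-saturated g X (saturated F)
    ; inner∈ = ∙∈◁ g X (inner∈ F)
    ; outer∉ = λ gz∈ → outer∉ F (subst (_∈ φ b X) (\\-leftDividesʳ g (outer F)) (∈◁⁻ g _ (φ-◁ b g X gz∈))) }

  -- `X` is an atom: no fragment of either direction has excess below `κ`, and `X` is smallest among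
  -- those of both directions with excess at most `κ`. With `κ < D` this is contradictory.
  module MinimalFragment (κ : ℕ) (κ<D : κ < D)
    (κ-minimal : ∀ {b Y} → Fragment b Y → ∣ Y ∣ + κ ≤ ∣ φ b Y ∣)
    {b : Bool} {X : Subset ∣G∣} (F : Fragment b X) (∣φX∣≤ : ∣ φ b X ∣ ≤ ∣ X ∣ + κ)
    (X-minimal : ∀ {b′ Y} → Fragment b′ Y → ∣ φ b′ Y ∣ ≤ ∣ Y ∣ + κ → ∣ X ∣ ≤ ∣ Y ∣)
    where

    open ≤-Reasoning

    -- The complement of `φ b X` is a fragment of the opposite direction with excess at most `κ`, so
    -- it competes with `X`; hence minimality is taken over both directions.
    ∣X∣≤∣∁φX∣ : ∣ X ∣ ≤ ∣ ∁ (φ b X) ∣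
    ∣X∣≤∣∁φX∣ = X-minimal (∁φ-fragment b F) (+-cancelˡ-≤ ∣ X ∣ _ _ (begin
      ∣ X ∣ + ∣ φ (not b) Y ∣    ≤⟨ +-monoʳ-≤ ∣ X ∣ (p⊆q⇒∣p∣≤∣q∣ (φ-∁φ b X)) ⟩
      ∣ X ∣ + ∣ ∁ X ∣            ≡⟨ ∣p∣+∣∁p∣≡n X ⟩
      ∣G∣                        ≡⟨ ∣p∣+∣∁p∣≡n (φ b X) ⟨
      ∣ φ b X ∣ + ∣ Y ∣          ≤⟨ +-monoˡ-≤ ∣ Y ∣ ∣φX∣≤ ⟩
      ∣ X ∣ + κ + ∣ Y ∣          ≡⟨ trans (+-assoc (∣ X ∣) κ (∣ Y ∣)) (cong (∣ X ∣ +_) (+-comm κ (∣ Y ∣))) ⟩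
      ∣ X ∣ + (∣ Y ∣ + κ)        ∎))
      where Y = ∁ (φ b X)

    2∣X∣+κ≤∣G∣ : ∣ X ∣ + (∣ X ∣ + κ) ≤ ∣G∣
    2∣X∣+κ≤∣G∣ = begin
      ∣ X ∣ + (∣ X ∣ + κ)          ≤⟨ +-mono-≤ ∣X∣≤∣∁φX∣ (κ-minimal F) ⟩
      ∣ ∁ (φ b X) ∣ + ∣ φ b X ∣    ≡⟨ +-comm _ ∣ φ b X ∣ ⟩
      ∣ φ b X ∣ + ∣ ∁ (φ b X) ∣    ≡⟨ ∣p∣+∣∁p∣≡n (φ b X) ⟩
      ∣G∣                          ∎

    -- Submodularity of X ↦ |φ X|: the intersection and the union of two intersecting minimal
    -- fragments are again extremal, the union being a fragment because 2|X| + κ ≤ |G|.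
    module Intersecting {Y : Subset ∣G∣} (F′ : Fragment b Y)
      (∣Y∣≡∣X∣ : ∣ Y ∣ ≡ ∣ X ∣) (∣φY∣≤ : ∣ φ b Y ∣ ≤ ∣ X ∣ + κ) {a} (a∈X : a ∈ X) (a∈Y : a ∈ Y) where

      I U φI φU : Subset ∣G∣
      I = X ∩ Y
      U = X ∪ Y
      φI = φ b X ∩ φ b Y
      φU = φ b X ∪ φ b Y

      I-fragment : Fragment b I
      I-fragment = record
        { saturated = λ x∼y x∈ → let x∈X , x∈Y = x∈p∩q⁻ X Y x∈ in
            x∈p∩q⁺ (saturated F x∼y x∈X , saturated F′ x∼y x∈Y)
        ; inner∈ = x∈p∩q⁺ (a∈X , a∈Y)
        ; outer∉ = outer∉ F ∘ φ-mono b (p∩q⊆p X Y) }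

      ∣φI∣≤ : ∣ φ b I ∣ ≤ ∣ φI ∣
      ∣φI∣≤ = p⊆q⇒∣p∣≤∣q∣ λ x∈ → x∈p∩q⁺ (φ-mono b (p∩q⊆p X Y) x∈ , φ-mono b (p∩q⊆q X Y) x∈)

      ∣φU∣+∣φI∣≤ : ∣ φU ∣ + ∣ φI ∣ ≤ ∣ X ∣ + κ + (∣ X ∣ + κ)
      ∣φU∣+∣φI∣≤ = begin
        ∣ φU ∣ + ∣ φI ∣              ≡⟨ ∣p∪q∣+∣p∩q∣≡∣p∣+∣q∣ (φ b X) (φ b Y) ⟩
        ∣ φ b X ∣ + ∣ φ b Y ∣        ≤⟨ +-mono-≤ ∣φX∣≤ ∣φY∣≤ ⟩
        ∣ X ∣ + κ + (∣ X ∣ + κ)      ∎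

      1≤∣I∣ : 1 ≤ ∣ I ∣
      1≤∣I∣ = subst (_≤ ∣ I ∣) (∣⁅x⁆∣≡1 a) (p⊆q⇒∣p∣≤∣q∣ λ x∈ →
        subst (_∈ I) (sym (x∈⁅y⁆⇒x≡y a x∈)) (x∈p∩q⁺ (a∈X , a∈Y)))

      -- Since `|φI| ≥ |I| + κ` with `I` nonempty, `|φU| ≤ 2|X| + 2κ − |φI| < 2|X| + κ ≤ |G|`.
      ∣φU∣<∣G∣ : ∣ φU ∣ < ∣G∣
      ∣φU∣<∣G∣ = +-cancelʳ-≤ κ _ _ (begin
        suc ∣ φU ∣ + κ                 ≡⟨ +-suc ∣ φU ∣ κ ⟨
        ∣ φU ∣ + (1 + κ)               ≤⟨ +-monoʳ-≤ ∣ φU ∣ (+-monoˡ-≤ κ 1≤∣I∣) ⟩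
        ∣ φU ∣ + (∣ I ∣ + κ)           ≤⟨ +-monoʳ-≤ ∣ φU ∣ (≤-trans (κ-minimal I-fragment) ∣φI∣≤) ⟩
        ∣ φU ∣ + ∣ φI ∣                ≤⟨ ∣φU∣+∣φI∣≤ ⟩
        ∣ X ∣ + κ + (∣ X ∣ + κ)        ≡⟨ cong (_+ (∣ X ∣ + κ)) (+-comm ∣ X ∣ κ) ⟩
        κ + ∣ X ∣ + (∣ X ∣ + κ)        ≡⟨ +-assoc κ ∣ X ∣ _ ⟩
        κ + (∣ X ∣ + (∣ X ∣ + κ))      ≤⟨ +-monoʳ-≤ κ 2∣X∣+κ≤∣G∣ ⟩
        κ + ∣G∣                        ≡⟨ +-comm κ ∣G∣ ⟩
        ∣G∣ + κ                        ∎)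

      U-fragment : Fragment b U
      U-fragment = record
        { saturated = λ x∼y x∈ → x∈p∪q⁺ ([ inj₁ ∘ saturated F x∼y , inj₂ ∘ saturated F′ x∼y ]′ (x∈p∪q⁻ X Y x∈))
        ; inner∈ = p⊆p∪q Y a∈X
        ; outer∉ = proj₂ (∣p∣<n⇒∃∉ ∣φU∣<∣G∣) ∘ φ-∪ b X Y }

      -- The excesses of `X` and `Y` sum to at most `2κ`, and the union takes up at least `κ` of it.
      ∣φI∣≤∣I∣+κ : ∣ φI ∣ ≤ ∣ I ∣ + κ
      ∣φI∣≤∣I∣+κ = +-cancelˡ-≤ (∣ U ∣ + κ) _ _ (begin
        ∣ U ∣ + κ + ∣ φI ∣             ≤⟨ +-monoˡ-≤ ∣ φI ∣ (≤-trans (κ-minimal U-fragment) (p⊆q⇒∣p∣≤∣q∣ (φ-∪ b X Y))) ⟩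
        ∣ φU ∣ + ∣ φI ∣                ≤⟨ ∣φU∣+∣φI∣≤ ⟩
        ∣ X ∣ + κ + (∣ X ∣ + κ)        ≡⟨ interchange (∣ X ∣) κ (∣ X ∣) κ ⟩
        ∣ X ∣ + ∣ X ∣ + (κ + κ)        ≡⟨ cong (λ z → ∣ X ∣ + z + (κ + κ)) ∣Y∣≡∣X∣ ⟨
        ∣ X ∣ + ∣ Y ∣ + (κ + κ)        ≡⟨ cong (_+ (κ + κ)) (∣p∪q∣+∣p∩q∣≡∣p∣+∣q∣ X Y) ⟨
        ∣ U ∣ + ∣ I ∣ + (κ + κ)        ≡⟨ interchange (∣ U ∣) (∣ I ∣) κ κ ⟩
        ∣ U ∣ + κ + (∣ I ∣ + κ)        ∎)

      -- As `I` has excess at most `κ`, minimality gives `|X| ≤ |I|`, so `I` is all of `X`.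
      X⊆Y : X ⊆ Y
      X⊆Y = p∩q⊆q X Y ∘ p⊆q∧∣q∣≤∣p∣⇒q⊆p (p∩q⊆p X Y)
        (X-minimal I-fragment (≤-trans ∣φI∣≤ ∣φI∣≤∣I∣+κ))

    -- The translate `gX` is a fragment with the same size as `X` and excess at most `κ`, and it
    -- meets `X` in `a`; hence `X ⊆ gX`.
    X-block : ∀ g {a} → a ∈ X → g ⁻¹ ∙ a ∈ X → ∀ {x} → x ∈ X → g ⁻¹ ∙ x ∈ X
    X-block g a∈X g⁻¹a∈X x∈X = ∈◁⁻ g X (Intersecting.X⊆Y (◁-fragment b g F)
      (≤-antisym (∣◁∣≤ g X) (≤∣◁∣ g X)) (≤-trans (∣φ◁∣≤ b g X) ∣φX∣≤) a∈X (∈◁⁺ g X g⁻¹a∈X) x∈X)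

    X-block′ : ∀ g {a} → a ∈ X → g ∙ a ∈ X → ∀ {x} → x ∈ X → g ∙ x ∈ X
    X-block′ g {a} a∈X ga∈X {x} x∈X = subst (λ z → z ∙ x ∈ X) (⁻¹-involutive g)
      (X-block (g ⁻¹) a∈X (subst (λ z → z ∙ a ∈ X) (sym (⁻¹-involutive g)) ga∈X) x∈X)

    a₀ : Fin ∣G∣
    a₀ = inner F

    K : Subset ∣G∣
    K = a₀ ⁻¹ ◁ X

    ∈K⁺ : ∀ {x} → a₀ ∙ x ∈ X → x ∈ K
    ∈K⁺ {x} = ∈◁⁺ (a₀ ⁻¹) X ∘ subst (λ z → z ∙ x ∈ X) (sym (⁻¹-involutive a₀))

    ∈K⁻ : ∀ {x} → x ∈ K → a₀ ∙ x ∈ X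
    ∈K⁻ {x} = subst (λ z → z ∙ x ∈ X) (⁻¹-involutive a₀) ∘ ∈◁⁻ (a₀ ⁻¹) X

    conj : ∀ u v → a₀ ∙ u ∙ a₀ ⁻¹ ∙ (a₀ ∙ v) ≡ a₀ ∙ (u ∙ v)
    conj u v = trans (assoc (a₀ ∙ u) (a₀ ⁻¹) (a₀ ∙ v))
      (trans (cong (a₀ ∙ u ∙_) (\\-leftDividesʳ a₀ v)) (assoc a₀ u v))

    conj-ε : ∀ u → a₀ ∙ u ∙ a₀ ⁻¹ ∙ a₀ ≡ a₀ ∙ u
    conj-ε u = //-rightDividesˡ a₀ (a₀ ∙ u)

    -- For `u ∈ K` the conjugate `a₀ ∙ u ∙ a₀ ⁻¹` sends `a₀` to `a₀ ∙ u`, both in `X`, so it maps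
    -- `X` into `X`, in particular `a₀ ∙ v` to `a₀ ∙ (u ∙ v)`. For inverses, the conjugate of `u ⁻¹`
    -- sends `a₀ ∙ u` back to `a₀`.
    K-isSubgroup : IsSubgroup G K
    K-isSubgroup = record
      { ε∈ = ∈K⁺ (subst (_∈ X) (sym (identityʳ a₀)) (inner∈ F))
      ; ∙∈ = λ {u} {v} u∈K v∈K → ∈K⁺ (subst (_∈ X) (conj u v)
          (X-block′ (a₀ ∙ u ∙ a₀ ⁻¹) (inner∈ F) (subst (_∈ X) (sym (conj-ε u)) (∈K⁻ u∈K)) (∈K⁻ v∈K)))
      ; ⁻¹∈ = λ {u} u∈K → ∈K⁺ (subst (_∈ X) (conj-ε (u ⁻¹))
          (X-block′ (a₀ ∙ u ⁻¹ ∙ a₀ ⁻¹) (∈K⁻ u∈K)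
            (subst (_∈ X) (sym (trans (conj (u ⁻¹) u) (trans (cong (a₀ ∙_) (inverseˡ u)) (identityʳ a₀)))) (inner∈ F))
            (inner∈ F))) }

    H⊆K : H ⊆ K
    H⊆K h∈H = ∈K⁺ (saturated F (x∼xh a₀ h∈H) (inner∈ F))

    -- `K` is a translate of `X`, so its boundary has at most `κ` elements, yet as a proper subgroup
    -- containing `H` it has boundary at least `D`.
    absurd : ⊥
    absurd = <⇒≱ κ<D (+-cancelˡ-≤ ∣ X ∣ _ _ (begin
      ∣ X ∣ + D                ≤⟨ +-mono-≤ (≤∣◁∣ (a₀ ⁻¹) X) (D≤∣∂K∣ b K-isSubgroup H⊆K (outer∉ K-fragment ∘ X⊆φX b K)) ⟩
      ∣ K ∣ + ∣ ∂ b k K ∣      ≤⟨ ∣X∣+∣∂X∣≤∣φX∣ b K ⟩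
      ∣ φ b K ∣                ≤⟨ ∣φ◁∣≤ b (a₀ ⁻¹) X ⟩
      ∣ φ b X ∣                ≤⟨ ∣φX∣≤ ⟩
      ∣ X ∣ + κ                ∎))
      where K-fragment = ◁-fragment b (a₀ ⁻¹) F

  -- Lexicographic induction on `κ` and `s` replaces the choice of a least excess and then a least
  -- size: the induction hypotheses are exactly the two minimality assumptions on an atom. When `κ`
  -- drops, `s` restarts at `|G|`, which bounds every size.
  no-small-fragment : ∀ κ s → κ < D → ∀ {b X} → Fragment b X →
                      ∣ φ b X ∣ ≤ ∣ X ∣ + κ → ∣ X ∣ ≤ s → ⊥
  no-small-fragment κ zero κ<D {X = X} F _ ∣X∣≤0 = contradiction
    (p⊆q⇒∣p∣≤∣q∣ {p = ⁅ inner F ⁆} (λ x∈ → subst (_∈ X) (sym (x∈⁅y⁆⇒x≡y _ x∈)) (inner∈ F)))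
    (<⇒≱ (subst (∣ X ∣ <_) (sym (∣⁅x⁆∣≡1 (inner F))) (s≤s ∣X∣≤0)))
  no-small-fragment zero (suc s) κ<D F ∣φX∣≤ ∣X∣≤ = MinimalFragment.absurd zero κ<D
    (λ {b} {Y} _ → ≤-trans (≤-reflexive (+-identityʳ ∣ Y ∣)) (p⊆q⇒∣p∣≤∣q∣ (X⊆φX b Y))) F ∣φX∣≤
    (λ F′ ∣φY∣≤ → ≤-trans ∣X∣≤ (≰⇒> (no-small-fragment zero s κ<D F′ ∣φY∣≤)))
  no-small-fragment (suc κ) (suc s) κ<D F ∣φX∣≤ ∣X∣≤ = MinimalFragment.absurd (suc κ) κ<D
    (λ {b} {Y} F′ → ≤-trans (≤-reflexive (+-suc ∣ Y ∣ κ))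
      (≰⇒> λ ∣φY∣≤ → no-small-fragment κ ∣G∣ (<⇒≤ κ<D) F′ ∣φY∣≤ (∣p∣≤n Y))) F ∣φX∣≤
    (λ F′ ∣φY∣≤ → ≤-trans ∣X∣≤ (≰⇒> (no-small-fragment (suc κ) s κ<D F′ ∣φY∣≤)))

  ∣X∣+D≤∣φX∣ : ∀ {b X} → Fragment b X → ∣ X ∣ + D ≤ ∣ φ b X ∣
  ∣X∣+D≤∣φX∣ {b} {X} F = ≮⇒≥ λ ∣φX∣<∣X∣+D →
    no-small-fragment (∣ φ b X ∣ ∸ ∣ X ∣) ∣G∣
      (+-cancelˡ-< ∣ X ∣ _ _ (subst (_< ∣ X ∣ + D) (sym eq) ∣φX∣<∣X∣+D)) F
      (≤-reflexive (sym eq)) (∣p∣≤n X)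
    where
    eq : ∣ X ∣ + (∣ φ b X ∣ ∸ ∣ X ∣) ≡ ∣ φ b X ∣
    eq = m+[n∸m]≡n (p⊆q⇒∣p∣≤∣q∣ (X⊆φX b X))

-- From boundaries to vertex connectivity.

module Connectivity (G : FinGroup) (H : Subset (FinGroup.n G)) (H-isSubgroup : IsSubgroup G H)
                    {k : ℕ} (S : Fin k → Fin (FinGroup.n G)) where
  open Connections G H H-isSubgroup S

  Edge? : ∀ x y → Dec (Edge x y)
  Edge? x y = map′ (E⇒Edge x y) (Edge⇒E x y) (E? true k x y)

  nonadjacent : ¬ Complete → ∃ λ u → ∃ λ v → IsRep u × IsRep v × u ≢ v × ¬ Edge u v
  nonadjacent ¬complete with any? (λ u → any? λ v →
    isRep? u ×-dec (isRep? v ×-dec (¬? (u ≟ v) ×-dec ¬? (Edge? u v))))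
  ... | yes found = found
  ... | no none = contradiction
    (λ u v u-rep v-rep u≢v → decidable-stable (Edge? u v) λ ¬e → none (u , v , u-rep , v-rep , u≢v , ¬e))
    ¬complete

  snoc : ∀ {V x y z} → Path V x y → Edge y z → V z → Path V x z
  snoc here e z∈V = step e z∈V here
  snoc (step e y∈V path) e′ z∈V = step e y∈V (snoc path e′ z∈V)

  -- Removing fewer vertices than the degree does not separate.

  module LowerBound (D≤∣∂K∣ : ∀ b {K} → IsSubgroup G K → H ⊆ K → ∀ {z} → z ∉ K →
                              degree * ∣ H ∣ ≤ ∣ ∂ b k K ∣)
                    {j : ℕ} (j<degree : j < degree) (X : VertexSet j) where
    open Atoms G H H-isSubgroup S (degree * ∣ H ∣) D≤∣∂K∣
    open VertexSet X

    kept? : Decidable (λ x → ∀ i → elt i ≢ rep x)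
    kept? x = all? λ i → ¬? (elt i ≟ rep x)

    kept : Subset ∣G∣
    kept = ⟦ kept? ⟧

    kept-saturated : Saturated kept
    kept-saturated {x} x∼y x∈ = ∈⟦⟧⁺ kept? (subst (λ r → ∀ i → elt i ≢ r) (∼⇒rep≡ x∼y) (∈⟦⟧⁻ kept? x∈))

    removed-covered : ∀ {x} → x ∈ ∁ kept → ∃ λ i → elt i ∼ x
    removed-covered {x} x∈ with any? (λ i → elt i ≟ rep x)
    ... | yes (i , eltᵢ≡) = i , subst (_∼ x) (sym eltᵢ≡) (rep∼x x)
    ... | no ∄i = contradiction (∈⟦⟧⁺ kept? λ i eq → ∄i (i , eq)) (x∈∁p⇒x∉p x∈)

    ∣removed∣<D : ∣ ∁ kept ∣ < degree * ∣ H ∣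
    ∣removed∣<D = ≤-trans (s≤s (∣X∣≤d*∣H∣ elt removed-covered))
      (≤-trans (+-monoˡ-≤ (j * ∣ H ∣) 1≤∣H∣) (*-monoˡ-≤ ∣ H ∣ j<degree))

    E⇒Edge-rep : ∀ x y → E true k x y → Edge (rep x) (rep y)
    E⇒Edge-rep x y = E⇒Edge (rep x) (rep y) ∘ E-resp true x (rep x) y (rep y) (x∼rep x) (x∼rep y)

    module _ {u v} (u-remains : Remaining X u) (v-remains : Remaining X v) where

      Reached : Fin ∣G∣ → Set
      Reached x = Remaining X (rep x) × Path (Remaining X) u (rep x)

      -- The reached set `A` is extended to the surviving part of its closed neighbourhood. While
      -- `φ true A` is not everything, `A` is a fragment: at least `D` elements are gained and fewer
      -- than `D` are removed, so `A` grows. Once `φ true A` is everything, `v` is in `A` or one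
      -- edge away.
      reach-from : ∀ fuel A → ∣G∣ ≤ ∣ A ∣ + fuel → Saturated A → u ∈ A →
                   (∀ {x} → x ∈ A → Reached x) → Path (Remaining X) u v
      reach-from fuel A enough A-sat u∈A reached with v ∈? A | any? (λ z → ¬? (z ∈? φ true A))
      ... | yes v∈A | _ = subst (Path (Remaining X) u) (IsRep⇒rep≡ (proj₁ v-remains)) (proj₂ (reached v∈A))
      ... | no v∉A | no φA-full with ∈φ⁻ true A (decidable-stable (v ∈? φ true A) λ v∉φA → φA-full (v , v∉φA))
      ...   | inj₁ v∈A = contradiction v∈A v∉A
      ...   | inj₂ (x , x∈A , e) = snoc (proj₂ (reached x∈A))
              (subst (Edge (rep x)) (IsRep⇒rep≡ (proj₁ v-remains)) (E⇒Edge-rep x v e)) v-remains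
      reach-from fuel A enough A-sat u∈A reached | no v∉A | yes (z , z∉φA) = continue fuel enough
        where
        open ≤-Reasoning
        A′ : Subset ∣G∣
        A′ = φ true A ∩ kept
        ∣A∣<∣A′∣ : ∣ A ∣ < ∣ A′ ∣
        ∣A∣<∣A′∣ = +-cancelʳ-< (∣ ∁ kept ∣) _ _ (begin-strict
          ∣ A ∣ + ∣ ∁ kept ∣            <⟨ +-monoʳ-< ∣ A ∣ ∣removed∣<D ⟩
          ∣ A ∣ + degree * ∣ H ∣        ≤⟨ ∣X∣+D≤∣φX∣ {true} (record { saturated = A-sat ; inner∈ = u∈A ; outer∉ = z∉φA }) ⟩
          ∣ φ true A ∣                  ≤⟨ ∣∣-cover (λ {x} x∈ → split x x∈ (x ∈? kept)) ⟩
          ∣ A′ ∣ + ∣ ∁ kept ∣           ∎)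
          where
          split : ∀ x → x ∈ φ true A → Dec (x ∈ kept) → x ∈ A′ ⊎ x ∈ ∁ kept
          split x x∈φA (yes x∈kept) = inj₁ (x∈p∩q⁺ (x∈φA , x∈kept))
          split x x∈φA (no x∉kept) = inj₂ (x∉p⇒x∈∁p x∉kept)
        reached′ : ∀ {x} → x ∈ A′ → Reached x
        reached′ {x} x∈A′ with x∈p∩q⁻ (φ true A) kept x∈A′
        ... | x∈φA , x∈kept with ∈φ⁻ true A x∈φA
        ...   | inj₁ x∈A = reached x∈A
        ...   | inj₂ (a , a∈A , e) = x-remains , snoc (proj₂ (reached a∈A)) (E⇒Edge-rep a x e) x-remains
          where
          x-remains : Remaining X (rep x)
          x-remains = rep-isRep x , ∈⟦⟧⁻ kept? x∈kept
        continue : ∀ fuel → ∣G∣ ≤ ∣ A ∣ + fuel → Path (Remaining X) u v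
        -- Without fuel `A` already has `|G|` elements, so it cannot grow.
        continue zero enough = contradiction (∣p∣≤n A′)
          (<⇒≱ (≤-trans (s≤s enough) (≤-trans (s≤s (≤-reflexive (+-identityʳ ∣ A ∣))) ∣A∣<∣A′∣)))
        continue (suc fuel) enough = reach-from fuel A′
          (≤-trans enough (≤-trans (≤-reflexive (+-suc ∣ A ∣ fuel)) (+-monoˡ-≤ fuel ∣A∣<∣A′∣)))
          (λ {x} x∼y x∈A′ → let x∈φA , x∈kept = x∈p∩q⁻ (φ true A) kept x∈A′ in
            x∈p∩q⁺ (φ-saturated true A A-sat x∼y x∈φA , kept-saturated x∼y x∈kept))
          (x∈p∩q⁺ (X⊆φX true A u∈A , ∈⟦⟧⁺ kept? (proj₂ (proj₁ (reached u∈A)))))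
          reached′

      reach : Path (Remaining X) u v
      reach = reach-from ∣G∣ ⟦ coset? u ⟧ (m≤n+m ∣G∣ _) (coset-saturated u) (∈⟦⟧⁺ (coset? u) (∼-refl u))
        λ {x} x∈ → let u≡rep = trans (sym (IsRep⇒rep≡ (proj₁ u-remains))) (∼⇒rep≡ (∈⟦⟧⁻ (coset? u) x∈)) in
          subst (λ r → Remaining X r × Path (Remaining X) u r) u≡rep (u-remains , here)

    -- A vertex `u` with a non-neighbour `v` has a coset that is a fragment, so `D < |G|`. If at
    -- most one vertex survived, its coset and the `j` removed ones would cover `G`, giving
    -- `|G| ≤ (j + 1)|H| ≤ D`.
    many-vertices : ¬ Complete → ¬ (∀ u v → Remaining X u → Remaining X v → u ≡ v)
    many-vertices ¬complete all-equal with nonadjacent ¬complete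
    ... | u , v , u-rep , v-rep , u≢v , ¬e = <⇒≱ D<∣G∣ ∣G∣≤D
      where
      open ≤-Reasoning
      U = ⟦ coset? u ⟧
      v∉φU : v ∉ φ true U
      v∉φU v∈ with ∈φ⁻ true U v∈
      ... | inj₁ v∈U = u≢v (IsRep-unique u-rep v-rep (∈⟦⟧⁻ (coset? u) v∈U))
      ... | inj₂ (x , x∈U , e) = ¬e (E⇒Edge u v
        (E-resp true x u v v (∼-sym u x (∈⟦⟧⁻ (coset? u) x∈U)) (∼-refl v) e))
      D<∣G∣ : degree * ∣ H ∣ < ∣G∣
      D<∣G∣ = begin-strict
        degree * ∣ H ∣              <⟨ m<n+m _ (≤-trans 1≤∣H∣ (∣H∣≤∣coset∣ u)) ⟩
        ∣ U ∣ + degree * ∣ H ∣      ≤⟨ ∣X∣+D≤∣φX∣ {true} (record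
          { saturated = coset-saturated u ; inner∈ = ∈⟦⟧⁺ (coset? u) (∼-refl u) ; outer∉ = v∉φU }) ⟩
        ∣ φ true U ∣                ≤⟨ ∣p∣≤n (φ true U) ⟩
        ∣G∣                         ∎
      survivor : ∃ λ w → ∀ {x} → x ∈ kept → w ∼ x
      survivor with any? (_∈? kept)
      -- If nothing survives, `u` is an arbitrary default.
      ... | no none = u , λ x∈kept → contradiction (_ , x∈kept) none
      ... | yes (w , w∈kept) = w , λ {x} x∈kept → ∼-trans w (rep w) x (x∼rep w)
        (subst (_∼ x)
          (all-equal (rep x) (rep w) (rep-isRep x , ∈⟦⟧⁻ kept? x∈kept) (rep-isRep w , ∈⟦⟧⁻ kept? w∈kept))
          (rep∼x x))
      ∣G∣≤D : ∣G∣ ≤ degree * ∣ H ∣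
      ∣G∣≤D = begin
        ∣G∣                         ≡⟨ ∣⊤∣≡n ∣G∣ ⟨
        ∣ ⊤ {∣G∣} ∣                 ≤⟨ ∣X∣≤d*∣H∣ (proj₁ survivor ∷ᶠ elt) {⊤} (λ {x} _ → cover x (x ∈? kept)) ⟩
        suc j * ∣ H ∣               ≤⟨ *-monoˡ-≤ ∣ H ∣ j<degree ⟩
        degree * ∣ H ∣              ∎
        where
        cover : ∀ x → Dec (x ∈ kept) → ∃ λ i → (proj₁ survivor ∷ᶠ elt) i ∼ x
        cover x (yes x∈kept) = zero , proj₂ survivor x∈kept
        cover x (no x∉kept) = let i , eltᵢ∼x = removed-covered (x∉p⇒x∈∁p x∉kept) in suc i , eltᵢ∼x

    not-separating : ¬ Complete → ¬ Separating X
    not-separating ¬complete (inj₁ ¬connected) = ¬connected λ u v → reach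
    not-separating ¬complete (inj₂ all-equal) = many-vertices ¬complete all-equal

  -- The out-neighbours of a vertex form a cut.

  module UpperBound (S∉H : ∀ i → S i ∉ H) (distinct : ∀ i j → i ≢ j → ¬ InDouble (S i) (S j)) where

    vertex-in? : ∀ i → Decidable (λ x → IsRep x × InDouble (S i) x)
    vertex-in? i x = isRep? x ×-dec inDouble? (S i) x

    vertices-in : Fin k → List (Fin ∣G∣)
    vertices-in i = filter (vertex-in? i) (allFin ∣G∣)

    -- Written as in the sum defining `degree`, so that `neighbours` has that length by
    -- `length-concat-map`.
    generators : List (Fin k)
    generators = filter (λ i → toℕ i <? k) (allFin k)

    neighbours : List (Fin ∣G∣)
    neighbours = concat (map vertices-in generators)

    ∈vertices-in⁻ : ∀ i {x} → x ∈ₗ vertices-in i → IsRep x × InDouble (S i) x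
    ∈vertices-in⁻ i x∈ = proj₂ (∈-filter⁻ (vertex-in? i) {xs = allFin ∣G∣} x∈)

    ∈neighbours⁻ : ∀ {x} → x ∈ₗ neighbours → IsRep x × ∃ λ i → InDouble (S i) x
    ∈neighbours⁻ x∈ with ∈-concat⁻′ (map vertices-in generators) x∈
    ... | _ , x∈xs , xs∈ with ∈-map⁻ vertices-in xs∈
    ...   | i , _ , refl = let x-rep , x∈HSᵢH = ∈vertices-in⁻ i x∈xs in x-rep , i , x∈HSᵢH

    ∈neighbours⁺ : ∀ {x} i → IsRep x → InDouble (S i) x → x ∈ₗ neighbours
    ∈neighbours⁺ {x} i x-rep x∈HSᵢH = ∈-concat⁺′
      (∈-filter⁺ (vertex-in? i) (∈-allFin x) (x-rep , x∈HSᵢH))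
      (∈-map⁺ vertices-in (∈-filter⁺ (λ i → toℕ i <? k) (∈-allFin i) (toℕ<n i)))

    -- Double cosets sharing `x` coincide: the equation `h ∙ S i ∙ h′ = g ∙ S j ∙ g′` is solved for
    -- `S j`.
    double-coset-sym : ∀ i j x → InDouble (S i) x → InDouble (S j) x → InDouble (S i) (S j)
    double-coset-sym i j x (h , h′ , h∈ , h′∈ , x≡) (g , g′ , g∈ , g′∈ , x≡′) =
      g ⁻¹ ∙ h , h′ ∙ g′ ⁻¹ , ∙∈H (⁻¹∈H g∈) h∈ , ∙∈H h′∈ (⁻¹∈H g′∈) , (begin
        S j                                       ≡⟨ \\-leftDividesʳ g (S j) ⟨
        g ⁻¹ ∙ (g ∙ S j)                          ≡⟨ cong (g ⁻¹ ∙_) (//-rightDividesʳ g′ (g ∙ S j)) ⟨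
        g ⁻¹ ∙ (g ∙ S j ∙ g′ ∙ g′ ⁻¹)             ≡⟨ cong (λ z → g ⁻¹ ∙ (z ∙ g′ ⁻¹)) (trans (sym x≡′) x≡) ⟩
        g ⁻¹ ∙ (h ∙ S i ∙ h′ ∙ g′ ⁻¹)             ≡⟨ cong (g ⁻¹ ∙_) (trans (assoc (h ∙ S i) h′ (g′ ⁻¹)) (assoc h (S i) _)) ⟩
        g ⁻¹ ∙ (h ∙ (S i ∙ (h′ ∙ g′ ⁻¹)))         ≡⟨ assoc (g ⁻¹) h _ ⟨
        g ⁻¹ ∙ h ∙ (S i ∙ (h′ ∙ g′ ⁻¹))           ≡⟨ assoc (g ⁻¹ ∙ h) (S i) _ ⟨
        g ⁻¹ ∙ h ∙ S i ∙ (h′ ∙ g′ ⁻¹)             ∎)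
      where open ≡-Reasoning

    neighbours-unique : Unique neighbours
    neighbours-unique = Unique.concat⁺
      (All.map⁺ (All.universal (λ i → Unique.filter⁺ (vertex-in? i) (Unique.allFin⁺ ∣G∣)) generators))
      (AllPairs.map⁺ (AllPairs.map
        (λ {i} {j} i≢j {x} (x∈ᵢ , x∈ⱼ) → distinct i j i≢j
          (double-coset-sym i j x (proj₂ (∈vertices-in⁻ i x∈ᵢ)) (proj₂ (∈vertices-in⁻ j x∈ⱼ))))
        (Unique.filter⁺ (λ i → toℕ i <? k) (Unique.allFin⁺ k))))

    length-neighbours : length neighbours ≡ degree
    length-neighbours = length-concat-map vertices-in generators

    InDouble⇒E : ∀ i x → InDouble (S i) x → E true k ε x
    InDouble⇒E i x (h , h′ , h∈H , h′∈H , x≡) = i , h , toℕ<n i , h∈H ,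
      subst₂ _∼_ (cong (_∙ S i) (sym (identityˡ h))) (sym x≡) (x∼xh (h ∙ S i) h′∈H)

    E⇒InDouble : ∀ x → E true k ε x → ∃ λ i → InDouble (S i) x
    E⇒InDouble x (i , h , _ , h∈H , e) = i , h , _ , h∈H , e ,
      sym (trans (cong (λ z → h ∙ S i ∙ ((z ∙ S i) ⁻¹ ∙ x)) (identityˡ h)) (\\-leftDividesˡ (h ∙ S i) x))

    InDouble⇒∉H : ∀ i {x} → InDouble (S i) x → x ∉ H
    InDouble⇒∉H i (h , h′ , h∈H , h′∈H , refl) x∈H =
      S∉H i (Subgroup.cancelˡ H-isSubgroup h∈H (Subgroup.cancelʳ H-isSubgroup h′∈H x∈H))

    -- For nonadjacent `u` and `v`, the out-neighbours of `u` are removed; they are the translates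
    -- by `u` of those of the coset `H`. Both `u` and `v` survive, and any path from `u` to `v`
    -- would have to begin at a removed vertex.
    separating-set : ¬ Complete → Σ (VertexSet degree) Separating
    separating-set ¬complete with nonadjacent ¬complete
    ... | u , v , u-rep , v-rep , u≢v , ¬e =
      subst (λ d → Σ (VertexSet d) Separating) length-neighbours (X , inj₁ disconnected)
      where
      nb : Fin (length neighbours) → Fin ∣G∣
      nb = List.lookup neighbours
      nb∈ : ∀ i → IsRep (nb i) × ∃ λ j → InDouble (S j) (nb i)
      nb∈ i = ∈neighbours⁻ (∈-lookup i)
      X : VertexSet (length neighbours)
      X = record
        { elt = λ i → rep (u ∙ nb i)
        ; inj = λ {i} {j} eq → Unique⇒lookup-injective neighbours-unique
            (IsRep-unique (proj₁ (nb∈ i)) (proj₁ (nb∈ j)) (∼-untranslate u (nb i) (nb j)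
              (∼-trans _ (rep (u ∙ nb j)) _ (rep≡⇒∼ eq) (rep∼x (u ∙ nb j)))))
        ; isVert = λ i → rep-isRep (u ∙ nb i) }
      E-nb : ∀ i → E true k u (u ∙ nb i)
      E-nb i = let _ , j , nb∈HSⱼH = nb∈ i in
        subst (λ z → E true k z (u ∙ nb i)) (identityʳ u)
          (E-translate true u ε (nb i) (InDouble⇒E j (nb i) nb∈HSⱼH))
      u-remains : Remaining X u
      u-remains = u-rep , λ i eq → InDouble⇒∉H _ (proj₂ (proj₂ (nb∈ i)))
        (subst (_∈ H) (\\-leftDividesʳ u (nb i))
          (∼-sym (u ∙ nb i) u (rep≡⇒∼ eq)))
      v-remains : Remaining X v
      v-remains = v-rep , λ i eq → ¬e (E⇒Edge u v
        (E-resp true u u (u ∙ nb i) v (∼-refl u) (rep≡⇒∼ eq) (E-nb i)))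
      neighbour-removed : ∀ {y} → Edge u y → IsRep y → ∃ λ i → VertexSet.elt X i ≡ y
      neighbour-removed {y} e y-rep = index ,
        IsRep-unique (rep-isRep _) y-rep (∼-trans _ (u ∙ nb index) y (rep∼x _)
          (subst (λ z → u ∙ z ∼ y) (lookup-index x∈)
            (subst (u ∙ x ∼_) (\\-leftDividesˡ u y) (∼-translate u x (u ⁻¹ ∙ y) (rep∼x (u ⁻¹ ∙ y))))))
        where
        x = rep (u ⁻¹ ∙ y)
        ε→x : E true k ε x
        ε→x = E-resp true (u ⁻¹ ∙ u) ε (u ⁻¹ ∙ y) x
          (subst (_∼ ε) (sym (inverseˡ u)) (∼-refl ε)) (x∼rep _)
          (E-translate true (u ⁻¹) u y (Edge⇒E u y e))
        x∈ : x ∈ₗ neighbours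
        x∈ = let i , x∈HSᵢH = E⇒InDouble x ε→x in ∈neighbours⁺ i (rep-isRep _) x∈HSᵢH
        index = Any.index x∈
      no-path : ¬ Path (Remaining X) u v
      no-path here = u≢v refl
      no-path (step e (y-rep , y∉X) _) = let i , eq = neighbour-removed e y-rep in y∉X i eq
      disconnected : ¬ StronglyConnected (Remaining X)
      disconnected connected = no-path (connected u v u-remains v-remains)

-- Both bounds for a hierarchical coset digraph.

theorem18 : (G : FinGroup) (H : Subset (FinGroup.n G)) → IsSubgroup G H →
    (k : ℕ) (S : Fin k → Fin (FinGroup.n G)) →
    (∀ i → S i ∉ H) →
    (∀ i j → i ≢ j → ¬ CosetGraph.InDouble G H S (S i) (S j)) →
    (∀ g → CosetGraph.Gsub G H S k g) →
    ¬ CosetGraph.Complete G H S →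
    (∀ i j → 1 ≤ i → i ≤ k → 1 ≤ j → j ≤ k → i ≢ j →
    ¬ (∀ g → (CosetGraph.Gsub G H S i g → CosetGraph.Gsub G H S j g)
    × (CosetGraph.Gsub G H S j g → CosetGraph.Gsub G H S i g))) →
    2 ≤ k →
    (∀ (i : Fin k) → 1 ≤ toℕ i →
    CosetGraph.dₛ G H S (S i) ≤ CosetGraph.dUpTo G H S (toℕ i)) →
    (Σ (Fin (CosetGraph.dUpTo G H S 2) → Fin (FinGroup.n G)) λ f →
    Injective _≡_ _≡_ f
    × (∀ x → CosetGraph.IsRep G H S (f x) × CosetGraph.Gsub G H S 1 (f x))) →
    CosetGraph.VertexConnectivity≡ G H S (CosetGraph.degree G H S)
theorem18 G H H-sub (suc k) S S∉H distinct generating ¬complete Gᵢ-distinct 2≤k d≤ (f , f-inj , f∈) =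
  UpperBound.separating-set S∉H distinct ¬complete ,
  λ j j<degree X → LowerBound.not-separating boundary j<degree X ¬complete
  where
  open Connections G H H-sub S
  open Connectivity G H H-sub S
  open Hierarchy G H H-sub S

  hierarchical : ∀ i → 1 ≤ toℕ i → ¬ Gsub (toℕ i) (S i)
  hierarchical i 1≤i Sᵢ∈ = Gᵢ-distinct (suc (toℕ i)) (toℕ i) (s≤s z≤n) (toℕ<n i) 1≤i (<⇒≤ (toℕ<n i))
    1+n≢n λ g → Gsub-suc i Sᵢ∈ , Gsub-mono (n≤1+n (toℕ i))

  open Bounds hierarchical (λ i 1≤i → *-monoˡ-≤ ∣ H ∣ (d≤ i 1≤i))
    -- `f` lists `d₂` distinct representatives in `G₁`; their cosets are disjoint parts of `K`.
    (λ K-sat G₁⊆K → d*∣H∣≤∣X∣ f f-inj (proj₁ ∘ f∈) K-sat (G₁⊆K ∘ proj₂ ∘ f∈))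

  -- A subgroup containing `H` and every generator is all of `G`, so a proper one misses some `S i`,
  -- as `D≤∣∂K∣` requires.
  boundary : ∀ b {K} → IsSubgroup G K → H ⊆ K → ∀ {z} → z ∉ K → degree * ∣ H ∣ ≤ ∣ ∂ b (suc k) K ∣
  boundary b {K} K-sub H⊆K {z} z∉K with any? (λ i → ¬? (S i ∈? K))
  ... | yes (i , Sᵢ∉K) = D≤∣∂K∣ b k ≤-refl K-sub H⊆K i (toℕ<n i) Sᵢ∉K
  ... | no S⊆K = contradiction
    (Gsub⊆ (suc k) K-sub H⊆K (λ i _ → decidable-stable (S i ∈? K) λ Sᵢ∉K → S⊆K (i , Sᵢ∉K)) (generating z)) z∉K
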